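{- Let $T$ be a tree on $n$ vertices and let $I, J$ be two $k$-path vertex covers of $T$. Then $I$ and $J$ are reconfigurable under $\mathsf{TJ}$ if and only if $|I| = |J|$. Moreover, a $\mathsf{TJ}$-sequence between them, if one exists, can be constructed in $O(n)$ time. Consequently, $k$-PVCR under $\mathsf{TJ}$ can be solved in linear time on trees.
   Context: Fix an integer $k \geq 2$. A $k$-path is a path on $k$ vertices. A vertex subset $I \subseteq V(G)$ is a $k$-path vertex cover of $G$ if every $k$-path in $G$ contains at least one vertex of $I$. A sequence $\langle I_0, \dots, I_\ell \rangle$ of $k$-path vertex covers of $G$ is a $\mathsf{TJ}$-sequence between $I_0$ and $I_\ell$ if for each $i<\ell$ there are vertices $x_i,y_i$ with $I_i \setminus I_{i+1} = \{x_i\}$ and $I_{i+1}\setminus I_i = \{y_i\}$. $I$ and $J$ are reconfigurable under $\mathsf{TJ}$ if a $\mathsf{TJ}$-sequence between them exists. The problem $k$-PVCR under $\mathsf{TJ}$: given a graph $G$ and two distinct $k$-path vertex covers $I,J$ of $G$, decide whether they are reconfigurable under $\mathsf{TJ}$. -}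

module Defs where

open import Data.Bool using (Bool; true; false; if_then_else_)
open import Data.Fin using (Fin; zero; suc; toℕ; inject₁; fromℕ)
open import Data.Fin.Subset using (Subset; _∈_; _─_; ⁅_⁆)
open import Data.List using (List; []; _∷_; [_]; _++_; length; map; concat; take; tabulate)
open import Data.List.Membership.Propositional using () renaming (_∈_ to _∈ˡ_)
open import Data.List.Relation.Unary.Any using (Any)
open import Data.List.Relation.Unary.Linked using (Linked)
open import Data.List.Relation.Unary.Unique.Propositional using (Unique)
open import Data.Nat using (ℕ; zero; suc; pred; _+_; _*_; _≤_; _≡ᵇ_; _<ᵇ_; NonZero)
open import Data.Product using (Σ-syntax; ∃-syntax; _×_)
open import Data.Sum using (_⊎_)
open import Data.Vec using (toList)
open import Function.Bundles using (_⇔_)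
open import Level using (0ℓ)
open import Relation.Binary.Construct.Closure.ReflexiveTransitive using (Star)
open import Relation.Binary.Core using (Rel)
open import Relation.Binary.Definitions using (Decidable; Symmetric; Irreflexive)
open import Relation.Binary.PropositionalEquality using (_≡_; _≢_)
open import Relation.Nullary using (¬_)

------------------------------------------------------------------------
-- Finite simple graphs and trees

record Graph (n : ℕ) : Set₁ where
  field
    Adj    : Rel (Fin n) 0ℓ
    adj?   : Decidable Adj
    sym    : Symmetric Adj
    irrefl : Irreflexive _≡_ Adj

open Graph public using (Adj)

IsPath : ∀ {n} → Graph n → List (Fin n) → Set
IsPath G p = Linked (Adj G) p × Unique p

Connected : ∀ {n} → Graph n → Set
Connected G = ∀ u v → Star (Adj G) u v

-- A cycle is a path u w … v on at least three vertices whose ends are adjacent.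
Acyclic : ∀ {n} → Graph n → Set
Acyclic G = ∀ u w ws v → IsPath G (u ∷ w ∷ ws ++ [ v ]) → ¬ Adj G v u

record IsTree {n} (G : Graph n) : Set where
  field
    nonempty  : NonZero n
    connected : Connected G
    acyclic   : Acyclic G

------------------------------------------------------------------------
-- k-path vertex covers and token jumping

IsPathVertexCover : ∀ {n} → ℕ → Graph n → Subset n → Set
IsPathVertexCover k G I = ∀ p → IsPath G p → length p ≡ k → Any (_∈ I) p

record TJSequence {n} (k : ℕ) (G : Graph n) (I J : Subset n) : Set where
  field
    ℓ       : ℕ
    cover   : Fin (suc ℓ) → Subset n
    isCover : ∀ i → IsPathVertexCover k G (cover i)
    start   : cover zero ≡ I
    end     : cover (fromℕ ℓ) ≡ J
    x y     : Fin ℓ → Fin n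
    removed : ∀ i → cover (inject₁ i) ─ cover (suc i) ≡ ⁅ x i ⁆
    added   : ∀ i → cover (suc i) ─ cover (inject₁ i) ≡ ⁅ y i ⁆

Reconfigurable : ∀ {n} → ℕ → Graph n → Subset n → Subset n → Set
Reconfigurable = TJSequence

------------------------------------------------------------------------
-- Machine model: a unit-cost random access machine with structured control
-- flow.  A program mentions finitely many registers and finitely many arrays,
-- each array having one cell for every natural number.  The only arithmetic is
-- successor and predecessor, so in time t no stored number can exceed the
-- largest initial number or program constant by more than t: linear-time
-- computations use O(log n)-bit words, and unit cost is not abused.

Reg Arr : Set
Reg = ℕ
Arr = ℕ

data Test : Set where
  _≐_ _≺_ : Reg → Reg → Test

infixr 4 _⨾_

data Program : Set where
  skip   : Program
  const  : Reg → ℕ → Program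
  copy   : Reg → Reg → Program
  inc    : Reg → Program
  dec    : Reg → Program
  load   : Reg → Arr → Reg → Program         -- load r a i  is  r := a[i]
  store  : Arr → Reg → Reg → Program         -- store a i r  is  a[i] := r
  _⨾_    : Program → Program → Program
  ifThen : Test → Program → Program → Program
  while  : Test → Program → Program

record State : Set where
  constructor ⟨_,_⟩
  field
    reg : Reg → ℕ
    arr : Arr → ℕ → ℕ

open State public

test : Test → State → Bool
test (r ≐ q) s = reg s r ≡ᵇ reg s q
test (r ≺ q) s = reg s r <ᵇ reg s q

setReg : Reg → ℕ → State → State
setReg r v s = ⟨ (λ q → if q ≡ᵇ r then v else reg s q) , arr s ⟩

setArr : Arr → ℕ → ℕ → State → State
setArr a i v s =
  ⟨ reg s , (λ b j → if b ≡ᵇ a then (if j ≡ᵇ i then v else arr s b j) else arr s b j) ⟩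

-- ⟪ P , s ⟫⇓ s′ ∣ t: started in state s, the program P halts in state s′ after
-- t elementary operations and tests.
infix 3 ⟪_,_⟫⇓_∣_

data ⟪_,_⟫⇓_∣_ : Program → State → State → ℕ → Set where
  skip    : ∀ {s} → ⟪ skip , s ⟫⇓ s ∣ 1
  const   : ∀ {r v s} → ⟪ const r v , s ⟫⇓ setReg r v s ∣ 1
  copy    : ∀ {r q s} → ⟪ copy r q , s ⟫⇓ setReg r (reg s q) s ∣ 1
  inc     : ∀ {r s} → ⟪ inc r , s ⟫⇓ setReg r (suc (reg s r)) s ∣ 1
  dec     : ∀ {r s} → ⟪ dec r , s ⟫⇓ setReg r (pred (reg s r)) s ∣ 1
  load    : ∀ {r a i s} → ⟪ load r a i , s ⟫⇓ setReg r (arr s a (reg s i)) s ∣ 1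
  store   : ∀ {a i r s} → ⟪ store a i r , s ⟫⇓ setArr a (reg s i) (reg s r) s ∣ 1
  _⨾_     : ∀ {P Q s s′ s″ t u} →
            ⟪ P , s ⟫⇓ s′ ∣ t → ⟪ Q , s′ ⟫⇓ s″ ∣ u → ⟪ P ⨾ Q , s ⟫⇓ s″ ∣ t + u
  ifTrue  : ∀ {b P Q s s′ t} → test b s ≡ true →
            ⟪ P , s ⟫⇓ s′ ∣ t → ⟪ ifThen b P Q , s ⟫⇓ s′ ∣ suc t
  ifFalse : ∀ {b P Q s s′ t} → test b s ≡ false →
            ⟪ Q , s ⟫⇓ s′ ∣ t → ⟪ ifThen b P Q , s ⟫⇓ s′ ∣ suc t
  done    : ∀ {b P s} → test b s ≡ false → ⟪ while b P , s ⟫⇓ s ∣ 1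
  loop    : ∀ {b P s s′ s″ t u} → test b s ≡ true →
            ⟪ P , s ⟫⇓ s′ ∣ t → ⟪ while b P , s′ ⟫⇓ s″ ∣ u →
            ⟪ while b P , s ⟫⇓ s″ ∣ suc (t + u)

HaltsWithin : Program → State → ℕ → (State → Set) → Set
HaltsWithin P s b Post = ∃[ s′ ] ∃[ t ] (⟪ P , s ⟫⇓ s′ ∣ t) × t ≤ b × Post s′

------------------------------------------------------------------------
-- Input and output conventions

record AdjacencyLists {n} (G : Graph n) : Set where
  field
    nbrs    : Fin n → List (Fin n)
    unique  : ∀ v → Unique (nbrs v)
    correct : ∀ v u → u ∈ˡ nbrs v ⇔ Adj G v u

open AdjacencyLists public using (nbrs)

cell : List ℕ → ℕ → ℕ
cell []       _       = 0
cell (v ∷ _)  zero    = v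
cell (_ ∷ vs) (suc i) = cell vs i

indicator : ∀ {n} → Subset n → List ℕ
indicator I = map (λ b → if b then 1 else 0) (toList I)

-- Register 0 holds n.  Array 1 is the concatenation of the adjacency lists;
-- the list of vertex v occupies the cells from a₀[v] up to, but excluding,
-- a₀[v + 1], where a₀ is array 0.  Arrays 2 and 3 are the characteristic
-- vectors of I and J.  Everything else is zero.
input : ∀ {n} {G : Graph n} → AdjacencyLists G → Subset n → Subset n → State
input {n} L I J = ⟨ registers , arrays ⟩
  where
  lists : List (List (Fin n))
  lists = tabulate (nbrs L)

  registers : Reg → ℕ
  registers 0 = n
  registers _ = 0

  arrays : Arr → ℕ → ℕ
  arrays 0 v = if v <ᵇ suc n then length (concat (take v lists)) else 0
  arrays 1   = cell (map toℕ (concat lists))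
  arrays 2   = cell (indicator I)
  arrays 3   = cell (indicator J)
  arrays _ _ = 0

-- A TJ-sequence is written down as its list of token jumps: register 1 holds ℓ,
-- and arrays 4 and 5 hold x and y.  Together with I this determines the
-- sequence; listing every cover in full could take quadratic space.
OutputsSequence : ∀ {n k} {G : Graph n} {I J : Subset n} →
                  TJSequence k G I J → State → Set
OutputsSequence S s =
  reg s 1 ≡ ℓ × (∀ i → arr s 4 (toℕ i) ≡ toℕ (x i)) × (∀ i → arr s 5 (toℕ i) ≡ toℕ (y i))
  where open TJSequence S

OutputsDecision : Set → State → Set
OutputsDecision A s = (A × reg s 1 ≡ 1) ⊎ (¬ A × reg s 1 ≡ 0)

ConstructibleInLinearTime : ℕ → Set₁
ConstructibleInLinearTime k =
  ∃[ P ] ∃[ c ] ∀ {n} (T : Graph n) (L : AdjacencyLists T) (I J : Subset n) →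
  IsTree T → IsPathVertexCover k T I → IsPathVertexCover k T J →
  Reconfigurable k T I J →
  HaltsWithin P (input L I J) (c * n)
    (λ s → Σ[ S ∈ TJSequence k T I J ] OutputsSequence S s)

PVCRSolvableInLinearTime : ℕ → Set₁
PVCRSolvableInLinearTime k =
  ∃[ P ] ∃[ c ] ∀ {n} (T : Graph n) (L : AdjacencyLists T) (I J : Subset n) →
  IsTree T → IsPathVertexCover k T I → IsPathVertexCover k T J → I ≢ J →
  HaltsWithin P (input L I J) (c * n) (OutputsDecision (Reconfigurable k T I J))

{-# OPTIONS --safe #-}

-- Root the tree and cut it bottom-up: v becomes a cut vertex when the part below
-- it that is not yet cut off contains a k-path through v.  This part contains a
-- token of every cover, and moving such a token to v keeps a cover, since a
-- k-path that avoids v and the earlier cut vertices stays below v and would have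
-- been cut before.  So I and J can be moved to covers I* and J* that contain all
-- cut vertices.  Every set with this property is a cover, hence the tokens in
-- which I* and J* differ can be exchanged in any order; the moves from J to J*
-- are then undone.  A depth-first search with an explicit stack, which carries
-- the height of the uncut part and one of its tokens, finds the moves in linear
-- time.

module Submission where

open import Defs
open import Data.Nat using (ℕ; _≤_)
open import Data.Fin.Subset using (Subset; ∣_∣)
open import Data.Product using (_×_)
open import Function.Bundles using (_⇔_)
open import Relation.Binary.PropositionalEquality using (_≡_)

open import Data.Bool using (Bool; true; false; if_then_else_; T; _∧_; not)
import Data.Bool.Properties as Bool
open import Data.Empty using (⊥; ⊥-elim)
open import Data.Fin using (Fin; zero; suc; toℕ; fromℕ; fromℕ<; inject₁)
open import Data.Fin.Induction using (<-weakInduction)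
import Data.Fin.Properties as Fin
open import Data.Fin.Subset using (_─_; ⁅_⁆; _⊂_)
open import Data.Fin.Subset.Properties using (∣⁅x⁆∣≡1; p⊂q⇒∣p∣<∣q∣)
import Data.List as List
open import Data.List
  using (List; []; _∷_; [_]; _++_; _ʳ++_; length; map; concat; take; tabulate; zip; filter; allFin)
open import Data.List.Membership.Propositional using (_∈_; _∉_; find; lose)
open import Data.List.Membership.Propositional.Properties
  using (∈-++⁺ˡ; ∈-++⁺ʳ; ∈-++⁻; ∈-∃++; ∈-lookup; ∈-filter⁺; ∈-filter⁻; ∈-allFin)
open import Data.List.Properties
  using (++-assoc; length-++; length-map; length-take; length-ʳ++; take++drop≡id)
open import Data.List.Relation.Unary.All using (All; []; _∷_)
import Data.List.Relation.Unary.All.Properties as All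
open import Data.List.Relation.Unary.AllPairs using ([]; _∷_)
open import Data.List.Relation.Unary.Any using (here; there; any?)
import Data.List.Relation.Unary.Any as Any
open import Data.List.Relation.Unary.Linked using (Linked; []; [-]; _∷_)
import Data.List.Relation.Unary.Linked as Linked
open import Data.List.Relation.Unary.Unique.Propositional using (Unique)
import Data.List.Relation.Unary.Unique.Propositional.Properties as Unique
open import Data.Maybe using (Maybe; just; nothing)
open import Data.Nat hiding (_⊔_)
open import Data.Nat.Properties
open import Data.Nat.Tactic.RingSolver using (solve-∀)
open import Data.Product using (Σ-syntax; ∃-syntax; _,_; proj₁; proj₂; swap)
open import Data.Sum using (_⊎_; inj₁; inj₂)
open import Data.Unit using (⊤; tt)
open import Data.Vec using ([]; _∷_; lookup; _[_]≔_)
open import Data.Vec.Properties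
  using (lookup∘update; lookup∘update′; []=⇒lookup; lookup⇒[]=; tabulate∘lookup; tabulate-cong; lookup-replicate)
open import Function using (_∘_)
open import Function.Bundles using (mk⇔; Equivalence)
open import Relation.Binary.Construct.Closure.ReflexiveTransitive using (Star; ε; _◅_)
open import Relation.Binary.PropositionalEquality hiding ([_])
open import Relation.Nullary using (¬_; yes; no; contradiction)

-- One token per uncut part suffices because of the invariant `Good`: whenever no token is in hand,
-- a path of `H` vertices hanging from the current vertex avoids the cover. So the height cannot
-- reach `k` without a token, as the cover would miss that path. The token in hand must also never
-- be one that holds a cut vertex; it is dropped at every cut, and `Settled` and `From` keep track
-- of this. Heights and cut vertices are computed without looking at the cover, so the searches for
-- both covers find the same cut vertices. The search keeps no visited marks. In an acyclic graph a
-- walk that never turns straight back is a path, so skipping only the vertex it came from makes the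
-- search finite and free of repetitions. The machine has no addition, so `H + h < k` is tested as
-- `H < k ∸ h`, with `k ∸ H` stored next to `H`. Heights, progress and the number of loop iterations
-- are recursions over the same type `Trav`, so one induction follows the loop.

-- Lists without repetition.

All∉ : ∀ {A : Set} {x : A} {xs} → x ∉ xs → All (x ≢_) xs
All∉ = All.¬Any⇒All¬ _

∉All : ∀ {A : Set} {x : A} {xs} → All (x ≢_) xs → x ∉ xs
∉All = All.All¬⇒¬Any

head∉tail : ∀ {A : Set} {x : A} {xs} → Unique (x ∷ xs) → x ∉ xs
head∉tail (x∉ ∷ _) = ∉All x∉

unique-++⁺ : ∀ {A : Set} {xs ys : List A} → Unique xs → Unique ys →
             (∀ w → w ∈ xs → w ∉ ys) → Unique (xs ++ ys)
unique-++⁺ ux uy dis = Unique.++⁺ ux uy (λ (p , q) → dis _ p q)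

unique-++⁻ˡ : ∀ {A : Set} (xs : List A) {ys} → Unique (xs ++ ys) → Unique xs
unique-++⁻ˡ []       _        = []
unique-++⁻ˡ (_ ∷ xs) (x∉ ∷ u) = All.++⁻ˡ xs x∉ ∷ unique-++⁻ˡ xs u

unique-++⁻ʳ : ∀ {A : Set} (xs : List A) {ys} → Unique (xs ++ ys) → Unique ys
unique-++⁻ʳ []       u       = u
unique-++⁻ʳ (_ ∷ xs) (_ ∷ u) = unique-++⁻ʳ xs u

unique-disjoint : ∀ {A : Set} (xs : List A) {ys} → Unique (xs ++ ys) →
                  ∀ {w} → w ∈ xs → w ∉ ys
unique-disjoint (_ ∷ xs) (x∉ ∷ _) (here refl) w∈ys = ∉All x∉ (∈-++⁺ʳ xs w∈ys)
unique-disjoint (_ ∷ xs) (_ ∷ u)  (there w∈)  w∈ys = unique-disjoint xs u w∈ w∈ys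

lookup-injective : ∀ {A : Set} {xs : List A} → Unique xs → ∀ {i j} → List.lookup xs i ≡ List.lookup xs j → i ≡ j
lookup-injective {xs = _ ∷ _} _        {zero}  {zero}  _ = refl
lookup-injective {xs = _ ∷ xs} u {zero}  {suc j} e = ⊥-elim (head∉tail u (subst (_∈ xs) (sym e) (∈-lookup j)))
lookup-injective {xs = _ ∷ xs} u {suc i} {zero}  e = ⊥-elim (head∉tail u (subst (_∈ xs) e (∈-lookup i)))
lookup-injective {xs = _ ∷ _} (_ ∷ u) {suc i} {suc j} e = cong suc (lookup-injective u e)

unique-length : ∀ {n} {xs : List (Fin n)} → Unique xs → length xs ≤ n
unique-length u = Fin.injective⇒≤ (lookup-injective u)

linked-++⁻ˡ : ∀ {A : Set} {R : A → A → Set} (xs : List A) {ys} → Linked R (xs ++ ys) → Linked R xs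
linked-++⁻ˡ []           _       = []
linked-++⁻ˡ (_ ∷ [])     _       = [-]
linked-++⁻ˡ (_ ∷ x ∷ xs) (r ∷ l) = r ∷ linked-++⁻ˡ (x ∷ xs) l

-- Paths, and non-backtracking walks in acyclic graphs.

module Paths {n : ℕ} (G : Graph n) where

  adj-sym : ∀ {u v} → Adj G u v → Adj G v u
  adj-sym = Graph.sym G

  adj-≢ : ∀ {u v} → Adj G u v → u ≢ v
  adj-≢ e eq = Graph.irrefl G eq e

  prefix : ∀ xs {ys} → IsPath G (xs ++ ys) → IsPath G xs
  prefix xs (l , u) = linked-++⁻ˡ xs l , unique-++⁻ˡ xs u

  -- The vertices of `v ∷ r` are moved one at a time to the front of the other path, which glues the
  -- two along the edge between `v` and `u`. This joins a path hanging from a vertex to one hanging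
  -- from its child.
  path-join : ∀ v r {u q} → IsPath G (v ∷ r) → IsPath G (u ∷ q) → Adj G v u →
              (∀ w → w ∈ v ∷ r → w ∉ u ∷ q) → IsPath G ((v ∷ r) ʳ++ (u ∷ q))
  path-join v [] _ (l , un) e dis = e ∷ l , All∉ (dis v (here refl)) ∷ un
  path-join v (z ∷ r) (e′ ∷ l′ , v∉ ∷ un′) (l , un) e dis =
    path-join z r (l′ , un′) (e ∷ l , All∉ (dis v (here refl)) ∷ un) (adj-sym e′)
      (λ { w w∈ (here refl) → ∉All v∉ w∈ ; w w∈ (there w∈′) → dis w (there w∈) w∈′ })

  ʳ++-⊆ : ∀ {P : Fin n → Set} r q → (∀ w → w ∈ r → P w) → (∀ w → w ∈ q → P w) →
          ∀ w → w ∈ r ʳ++ q → P w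
  ʳ++-⊆ []      q _  Pq = Pq
  ʳ++-⊆ (x ∷ r) q Pr Pq =
    ʳ++-⊆ r (x ∷ q) (λ w → Pr w ∘ there) (λ { w (here refl) → Pr w (here refl) ; w (there i) → Pq w i })

  -- Both arms start at `u`, the left one reversed, so that a path through its highest vertex
  -- becomes two descending paths. In `lengths` the vertex `u` counts once.
  record SplitAt (u : Fin n) (m : ℕ) (P : Fin n → Set) : Set where
    field
      left right : List (Fin n)
      left-path  : IsPath G (u ∷ left)
      right-path : IsPath G (u ∷ right)
      disjoint   : ∀ w → w ∈ left → w ∉ right
      lengths    : length left + suc (length right) ≡ m
      left-⊆     : ∀ w → w ∈ left → P w
      right-⊆    : ∀ w → w ∈ right → P w

  splitAt : ∀ {u P} acc x xs → IsPath G (x ∷ acc) → IsPath G (x ∷ xs) →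
            (∀ w → w ∈ acc → w ∉ xs) → (∀ w → w ∈ acc → P w) → (∀ w → w ∈ x ∷ xs → P w) →
            u ∈ x ∷ xs → SplitAt u (length acc + suc (length xs)) P
  splitAt acc x xs pa px dis Pa Px (here refl) = record
    { left = acc ; right = xs ; left-path = pa ; right-path = px ; disjoint = dis
    ; lengths = refl ; left-⊆ = Pa ; right-⊆ = λ w → Px w ∘ there }
  splitAt {u} {P} acc x (y ∷ ys) (la , ua) (e ∷ l , x∉ ∷ un) dis Pa Px (there u∈) =
    subst (λ m → SplitAt u m P) (sym (+-suc _ _))
      (splitAt (x ∷ acc) y ys
        (adj-sym e ∷ la , ((adj-≢ e ∘ sym) ∷ All∉ (λ y∈ → dis y y∈ (here refl))) ∷ ua)
        (l , un)
        (λ { w (here refl) w∈ → ∉All x∉ (there w∈) ; w (there i) w∈ → dis w i (there w∈) })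
        (λ { w (here refl) → Px w (here refl) ; w (there i) → Pa w i })
        (λ w → Px w ∘ there) u∈)

  split : ∀ {u P} q → IsPath G q → (∀ w → w ∈ q → P w) → u ∈ q → SplitAt u (length q) P
  split (x ∷ xs) pq Pq = splitAt [] x xs ([-] , [] ∷ []) pq (λ _ ()) (λ _ ()) Pq

  -- A local condition, unlike `Unique`: extending it at the head involves the next two vertices
  -- only. `nb⇒unique` turns it into a path.
  data NonBacktracking : List (Fin n) → Set where
    [-]  : ∀ {x} → NonBacktracking (x ∷ [])
    edge : ∀ {x y} → Adj G x y → NonBacktracking (x ∷ y ∷ [])
    turn : ∀ {x y z zs} → Adj G x y → x ≢ z → NonBacktracking (y ∷ z ∷ zs) →
           NonBacktracking (x ∷ y ∷ z ∷ zs)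

  nb⇒linked : ∀ {p} → NonBacktracking p → Linked (Adj G) p
  nb⇒linked [-]          = [-]
  nb⇒linked (edge e)     = e ∷ [-]
  nb⇒linked (turn e _ w) = e ∷ nb⇒linked w

  module _ (acyclic : Acyclic G) where

    -- If `x` recurred beyond `z`, the stretch from `y` to that occurrence would be a path by
    -- induction, and the edge between `x` and `y` would close a cycle.
    nb⇒unique : ∀ {p} → NonBacktracking p → Unique p
    nb⇒unique [-]   = [] ∷ []
    nb⇒unique (edge e) = (adj-≢ e ∷ []) ∷ [] ∷ []
    nb⇒unique (turn {x} {y} {z} {zs} e x≢z w) =
      (adj-≢ e ∷ x≢z ∷ All∉ x∉zs) ∷ un
      where
      un = nb⇒unique w
      x∉zs : x ∉ zs
      x∉zs x∈ with ∈-∃++ x∈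
      ... | ws , rest , refl =
        acyclic y z ws x
          (prefix (y ∷ z ∷ ws ++ [ x ])
            (subst (λ l → IsPath G (y ∷ z ∷ l)) (sym (++-assoc ws [ x ] rest)) (nb⇒linked w , un)))
          e

-- Depth-first traversals.

module Traversal {n : ℕ} {G : Graph n} (L : AdjacencyLists G) where
  open Paths G

  -- A traversal of the neighbours us of v that have not been visited yet,
  -- where v was entered from p.  The root is entered from the non-vertex n.
  data Trav : ℕ → Fin n → List (Fin n) → Set where
    []   : ∀ {p v} → Trav p v []
    skip : ∀ {p v u us} → toℕ u ≡ p → Trav p v us → Trav p v (u ∷ us)
    down : ∀ {p v u us} → toℕ u ≢ p → Adj G v u → Trav (toℕ v) u (nbrs L u) →
           Trav p v us → Trav p v (u ∷ us)

  verts : ∀ {p v us} → Trav p v us → List (Fin n)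
  verts []                   = []
  verts (skip _ t)           = verts t
  verts (down {u = u} _ _ c t) = (u ∷ verts c) ++ verts t

  data Sub : ∀ {p v us} → Trav p v us → (u : Fin n) → Trav (toℕ v) u (nbrs L u) → Set where
    here  : ∀ {p v u us ne e c} {t : Trav p v us} → Sub (down ne e c t) u c
    there : ∀ {p v u u′ us ne e c c′} {t : Trav p v us} → Sub t u c → Sub (down {u = u′} ne e c′ t) u c
    skip  : ∀ {p v u u′ us e c} {t : Trav p v us} → Sub t u c → Sub (skip {u = u′} e t) u c

  find-sub : ∀ {p v us w} (t : Trav p v us) → w ∈ verts t →
             ∃[ u ] ∃[ c ] Sub t u c × w ∈ u ∷ verts c
  find-sub (skip _ t) w∈ with find-sub t w∈
  ... | u , c , s , w∈′ = u , c , skip s , w∈′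
  find-sub (down {u = u} _ _ c t) w∈ with ∈-++⁻ (u ∷ verts c) w∈
  ... | inj₁ w∈′ = u , c , here , w∈′
  ... | inj₂ w∈′ with find-sub t w∈′
  ...   | u′ , c′ , s , w∈″ = u′ , c′ , there s , w∈″

  sub-⊆ : ∀ {p v us u c w} {t : Trav p v us} → Sub t u c → w ∈ u ∷ verts c → w ∈ verts t
  sub-⊆ here w∈ = ∈-++⁺ˡ w∈
  sub-⊆ {t = down {u = u} _ _ c _} (there s) w∈ = ∈-++⁺ʳ (u ∷ verts c) (sub-⊆ s w∈)
  sub-⊆ (skip s) w∈ = sub-⊆ s w∈

  sub-unique : ∀ {p v us u c} {t : Trav p v us} → Sub t u c → Unique (verts t) → Unique (u ∷ verts c)
  sub-unique {t = down {u = u} _ _ c _} here un = unique-++⁻ˡ (u ∷ verts c) un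
  sub-unique {t = down {u = u} _ _ c _} (there s) un = sub-unique s (unique-++⁻ʳ (u ∷ verts c) un)
  sub-unique (skip s) un = sub-unique s un

  -- Induction over the tree rather than over the data type: the traversals of all children are
  -- available at once, and the remaining neighbours of `v` are no case of their own.
  sub-ind : (P : ∀ {p v us} → Trav p v us → Set) →
            (∀ {p v us} (t : Trav p v us) → (∀ {u c} → Sub t u c → P c) → P t) →
            ∀ {p v us} (t : Trav p v us) → P t
  sub-ind P step t = step t (below t)
    where
    below : ∀ {p v us} (t : Trav p v us) → ∀ {u c} → Sub t u c → P c
    below (down _ _ c _) here      = step c (below c)
    below (down _ _ _ t) (there s) = below t s
    below (skip _ t)     (skip s)  = below t s

  covers : ∀ {p v us z} (t : Trav p v us) → z ∈ us → toℕ z ≡ p ⊎ z ∈ verts t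
  covers (skip e t) (here refl) = inj₁ e
  covers (skip e t) (there z∈)  = covers t z∈
  covers (down _ _ c t) (here refl) = inj₂ (here refl)
  covers (down {u = u} _ _ c t) (there z∈) with covers t z∈
  ... | inj₁ e   = inj₁ e
  ... | inj₂ z∈′ = inj₂ (∈-++⁺ʳ (u ∷ verts c) z∈′)

  mutual
    -- `nbrs L u` is the full neighbourhood and `covers` accounts for every entry but the parent, so
    -- an edge can leave a branch only towards the vertex numbered `p`.
    closed : ∀ {p u w z} (c : Trav p u (nbrs L u)) → w ∈ u ∷ verts c → Adj G w z →
             z ∈ u ∷ verts c ⊎ toℕ z ≡ p
    closed {u = u} c (here refl) e with covers c (Equivalence.from (AdjacencyLists.correct L u _) e)
    ... | inj₁ eq = inj₂ eq
    ... | inj₂ z∈ = inj₁ (there z∈)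
    closed c (there w∈) e = inj₁ (closed-forest c w∈ e)

    closed-forest : ∀ {p v us w z} (t : Trav p v us) → w ∈ verts t → Adj G w z → z ∈ v ∷ verts t
    closed-forest (skip _ t) w∈ e = closed-forest t w∈ e
    closed-forest (down {u = u} _ _ c t) w∈ e with ∈-++⁻ (u ∷ verts c) w∈
    ... | inj₁ w∈c with closed c w∈c e
    ...   | inj₁ z∈ = there (∈-++⁺ˡ z∈)
    ...   | inj₂ eq = here (Fin.toℕ-injective eq)
    closed-forest (down {u = u} _ _ c t) w∈ e | inj₂ w∈t with closed-forest t w∈t e
    ...   | here eq  = here eq
    ...   | there z∈ = there (∈-++⁺ʳ (u ∷ verts c) z∈)

  closed-sub : ∀ {p v us u c w z} {t : Trav p v us} → Sub t u c → w ∈ u ∷ verts c → Adj G w z →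
               z ∈ u ∷ verts c ⊎ z ≡ v
  closed-sub {c = c} _ w∈ e with closed c w∈ e
  ... | inj₁ z∈ = inj₁ z∈
  ... | inj₂ eq = inj₂ (Fin.toℕ-injective eq)

  -- The only exit from a branch is `v`, which does not occur in the list, so the branch of the
  -- first vertex holds the whole list.
  locate : ∀ {p v us x q} (t : Trav p v us) → v ∉ verts t → Linked (Adj G) (x ∷ q) →
           (∀ w → w ∈ x ∷ q → w ∈ verts t) →
           ∃[ u ] ∃[ c ] Sub t u c × (∀ w → w ∈ x ∷ q → w ∈ u ∷ verts c)
  locate {v = v} t v∉ l q⊆ with find-sub t (q⊆ _ (here refl))
  ... | u , c , s , x∈ = u , c , s , go _ _ l q⊆ x∈
    where
    go : ∀ x q → Linked (Adj G) (x ∷ q) → (∀ w → w ∈ x ∷ q → w ∈ verts t) → x ∈ u ∷ verts c →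
         ∀ w → w ∈ x ∷ q → w ∈ u ∷ verts c
    go x q l q⊆ x∈ w (here refl) = x∈
    go x (y ∷ q) (e ∷ l) q⊆ x∈ w (there w∈) with closed-sub s x∈ e
    ... | inj₁ y∈ = go y q l (λ w → q⊆ w ∘ there) y∈ w w∈
    ... | inj₂ refl = ⊥-elim (v∉ (q⊆ v (there (here refl))))

  below-step : ∀ {p u us w z} (c : Trav p u us) → w ∈ verts c → Adj G w z → u ≢ z → z ∈ verts c
  below-step c w∈ e u≢z with closed-forest c w∈ e
  ... | here refl = ⊥-elim (u≢z refl)
  ... | there z∈  = z∈

  -- Edges leave `verts c` only towards `u`. The list is followed in both directions from the vertex
  -- known to lie below `u`.
  trapped : ∀ {p u us} (c : Trav p u us) q → Linked (Adj G) q → u ∉ q →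
            ∀ {w} → w ∈ q → w ∈ verts c → ∀ z → z ∈ q → z ∈ verts c
  trapped c (x ∷ q) l u∉ (here refl) w∈c z (here refl) = w∈c
  trapped c (x ∷ y ∷ q) (e ∷ l) u∉ (here refl) w∈c z (there z∈) =
    trapped c (y ∷ q) l (u∉ ∘ there) (here refl) (below-step c w∈c e (λ eq → u∉ (there (here eq)))) z z∈
  trapped c (x ∷ q) l u∉ (there w∈) w∈c z (there z∈) =
    trapped c q (Linked.tail l) (u∉ ∘ there) w∈ w∈c z z∈
  trapped c (x ∷ y ∷ q) (e ∷ l) u∉ (there w∈) w∈c z (here refl) =
    below-step c (trapped c (y ∷ q) l (u∉ ∘ there) w∈ w∈c y (here refl)) (adj-sym e) (u∉ ∘ here)

  module _ (acyclic : Acyclic G) where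

    -- The last hypothesis ties `p` to the walk: `v` was entered from the head of `l`, so
    -- `toℕ u ≢ p` says that the new step does not turn back. At the root `l` is empty and the
    -- hypothesis is vacuous.
    retreat : ∀ {p u v} l → toℕ u ≢ p → Adj G v u → NonBacktracking (v ∷ l) →
              (∀ x l′ → l ≡ x ∷ l′ → p ≡ toℕ x) → NonBacktracking (u ∷ v ∷ l)
    retreat []      _  e _  _   = edge (adj-sym e)
    retreat (y ∷ l) ne e nb top = turn (adj-sym e) (λ eq → ne (trans (cong toℕ eq) (sym (top y l refl)))) nb

    ascend : ∀ {p u us l w} (c : Trav p u us) → NonBacktracking (u ∷ l) →
             (∀ x l′ → l ≡ x ∷ l′ → p ≡ toℕ x) → w ∈ u ∷ verts c →
             ∃[ l′ ] NonBacktracking (w ∷ l′) × (∀ z → z ∈ l → z ∈ l′)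
    ascend c nb top (here refl) = _ , nb , λ _ z∈ → z∈
    ascend (skip _ t) nb top (there w∈) = ascend t nb top (there w∈)
    ascend {u = u} {l = l} (down {u = x} ne e c t) nb top (there w∈) with ∈-++⁻ (x ∷ verts c) w∈
    ... | inj₂ w∈t = ascend t nb top (there w∈t)
    ... | inj₁ w∈c with ascend {l = u ∷ l} c (retreat l ne e nb top) (λ { _ _ refl → refl }) w∈c
    ... | l′ , nb′ , l⊆ = l′ , nb′ , λ z z∈ → l⊆ z (there z∈)

    -- The facts about the first step `z` serve the callers: `toℕ z ≢ p` permits one more vertex in
    -- front, and `z ∈ us` tells this branch from another one at the same vertex.
    descend : ∀ {p u us w} (c : Trav p u us) → w ∈ verts c →
              ∃[ z ] ∃[ l ] NonBacktracking (u ∷ z ∷ l) × w ∈ z ∷ l × z ∈ us × toℕ z ≢ p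
    descend (skip _ t) w∈ with descend t w∈
    ... | z , l , nb , w∈l , z∈ , ne = z , l , nb , w∈l , there z∈ , ne
    descend (down {u = x} ne e c t) w∈ with ∈-++⁻ (x ∷ verts c) w∈
    ... | inj₁ (here refl) = x , [] , edge e , here refl , here refl , ne
    ... | inj₁ (there w∈c) with descend c w∈c
    ...   | z , l , nb , w∈l , _ , ne′ =
      x , z ∷ l , turn e (λ { refl → ne′ refl }) nb , there w∈l , here refl , ne
    descend (down _ _ _ t) w∈ | inj₂ w∈t with descend t w∈t
    ... | z , l , nb , w∈l , z∈ , ne = z , l , nb , w∈l , there z∈ , ne

    root∉verts : ∀ {p v us} (t : Trav p v us) → v ∉ verts t
    root∉verts t v∈ with descend t v∈
    ... | z , l , nb , v∈l , _ = head∉tail (nb⇒unique acyclic nb) v∈l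

    -- A vertex in two branches at v would be met twice by the non-backtracking
    -- walk that climbs from it to v in one branch and descends in the other.
    verts-unique : ∀ {p v us} (t : Trav p v us) → Unique us → Unique (verts t)
    verts-unique [] _ = []
    verts-unique (skip _ t) (_ ∷ un) = verts-unique t un
    verts-unique {v = v} (down {u = u} ne e c t) (u∉ ∷ un) =
      unique-++⁺ {xs = u ∷ verts c}
        (All∉ (root∉verts c) ∷ verts-unique c (AdjacencyLists.unique L u))
        (verts-unique t un) apart
      where
      apart : ∀ w → w ∈ u ∷ verts c → w ∉ verts t
      apart w w∈c w∈t with descend t w∈t
      ... | z , l , nb , w∈l , z∈ , _
        with ascend {l = v ∷ z ∷ l} c (turn (adj-sym e) (λ { refl → ∉All u∉ z∈ }) nb) (λ { _ _ refl → refl }) w∈c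
      ...   | l′ , nb′ , l⊆ = head∉tail (nb⇒unique acyclic nb′) (l⊆ w (there w∈l))

    tree-unique : ∀ {p v} (t : Trav p v (nbrs L v)) → Unique (v ∷ verts t)
    tree-unique {v = v} t = All∉ (root∉verts t) ∷ verts-unique t (AdjacencyLists.unique L v)

    visit : ∀ {p v u us} → Adj G v u → (toℕ u ≢ p → Trav (toℕ v) u (nbrs L u)) →
            Trav p v us → Trav p v (u ∷ us)
    visit {p} {u = u} e c t with toℕ u ≟ p
    ... | yes eq = skip eq t
    ... | no ne  = down ne e (c ne) t

    -- A non-backtracking walk is a path, so it has at most n vertices and the
    -- search for a traversal terminates.
    build : ∀ m {v l} → n < m + length (v ∷ l) → NonBacktracking (v ∷ l) →
            ∀ p → (∀ x l′ → l ≡ x ∷ l′ → p ≡ toℕ x) → (∀ us → (∀ u → u ∈ us → Adj G v u) → Trav p v us)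
    build m bound nb p top [] _ = []
    build zero bound nb p top (u ∷ us) adj = ⊥-elim (<⇒≱ bound (unique-length (nb⇒unique acyclic nb)))
    build (suc m) {v} {l} bound nb p top (u ∷ us) adj =
      visit (adj u (here refl))
        (λ ne → build m (subst (n <_) (sym (+-suc m _)) bound) (retreat l ne (adj u (here refl)) nb top)
                  (toℕ v) (λ { _ _ refl → refl })
                  (nbrs L u) (λ w → Equivalence.to (AdjacencyLists.correct L u w)))
        (build (suc m) bound nb p top us (λ w → adj w ∘ there))

    traverse : ∀ v → Trav n v (nbrs L v)
    traverse v = build n (subst (n <_) (+-comm 1 n) (n<1+n n)) [-] n (λ _ _ ())
                   (nbrs L v) (λ w → Equivalence.to (AdjacencyLists.correct L v w))

  size : ∀ {p v us} → Trav p v us → ℕ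
  size t = length (verts t)

  -- The number of iterations of the machine's loop: one for passing over the parent, and for each
  -- child one to push it and one to return from it.
  turns : ∀ {p v us} → Trav p v us → ℕ
  turns []             = 0
  turns (skip _ t)     = suc (turns t)
  turns (down _ _ c t) = suc (turns c + suc (turns t))

  mutual
    -- Every vertex below `v` pays for its push, its return and the one entry of its own list that
    -- is its parent; the entries are distinct, so there is no second one. The extra 1 is that entry
    -- in the list of `v`.
    turns-≤ : ∀ {p v us} (t : Trav p v us) → Unique us → turns t ≤ suc (3 * size t)
    turns-≤ []                   _        = z≤n
    turns-≤ (skip e t)           (u∉ ∷ _) = s≤s (turns-no-skip t (λ z z∈ eq → ∉All u∉ (subst (_∈ _) (Fin.toℕ-injective (trans eq (sym e))) z∈)))
    turns-≤ (down {u = u} _ _ c t) (_ ∷ un) = turns-down 1 c t (turns-≤ t un)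

    turns-no-skip : ∀ {p v us} (t : Trav p v us) → (∀ z → z ∈ us → toℕ z ≢ p) → turns t ≤ 3 * size t
    turns-no-skip []             _  = z≤n
    turns-no-skip (skip e t)     ne = ⊥-elim (ne _ (here refl) e)
    turns-no-skip (down _ _ c t) ne = turns-down 0 c t (turns-no-skip t (λ z → ne z ∘ there))

    -- `m` is 1 as long as the parent may still occur in `us`, and 0 when it is known not to.
    turns-down : ∀ {p v u us} m (c : Trav (toℕ v) u (nbrs L u)) (t : Trav p v us) →
                 turns t ≤ m + 3 * size t → suc (turns c + suc (turns t)) ≤ m + 3 * length ((u ∷ verts c) ++ verts t)
    turns-down {u = u} m c t le = ≤-trans
      (s≤s (+-mono-≤ (turns-≤ c (AdjacencyLists.unique L u)) (s≤s le)))
      (≤-reflexive (trans (sum m (size c) (size t)) (cong (λ z → m + 3 * z) (sym (length-++ (u ∷ verts c))))))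
      where
      sum : ∀ m a b → suc (suc (3 * a) + suc (m + 3 * b)) ≡ m + 3 * (suc a + b)
      sum = solve-∀

<∸⇒+< : ∀ {m n o} → m < n ∸ o → m + o < n
<∸⇒+< {m} {n} {o} lt =
  subst (m + o <_) (m∸n+n≡m (<⇒≤ (m∸n≢0⇒n<m {n} {o} (λ e → n≮0 (subst (m <_) e lt))))) (+-monoˡ-< o lt)

-- Token moves and runs of jumps.

move : ∀ {n} → Subset n → Fin n → Fin n → Subset n
move S x y = S [ x ]≔ false [ y ]≔ true

module _ {n : ℕ} (S : Subset n) where

  move-target : ∀ x y → lookup (move S x y) y ≡ true
  move-target x y = lookup∘update y (S [ x ]≔ false) true

  move-source : ∀ {x y} → x ≢ y → lookup (move S x y) x ≡ false
  move-source {x} {y} x≢y = trans (lookup∘update′ x≢y (S [ x ]≔ false) true) (lookup∘update x S false)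

  move-other : ∀ {x y w} → w ≢ x → w ≢ y → lookup (move S x y) w ≡ lookup S w
  move-other {x} w≢x w≢y = trans (lookup∘update′ w≢y (S [ x ]≔ false) true) (lookup∘update′ w≢x S false)

module Runs {n : ℕ} (k : ℕ) (G : Graph n) where
  open Paths G

  Cover : Subset n → Set
  Cover = IsPathVertexCover k G

  cover-hits : ∀ {S q} → Cover S → IsPath G q → k ≤ length q →
               (∀ w → w ∈ q → lookup S w ≡ false) → ⊥
  cover-hits {S} {q} cov pq k≤ out
    with find (cov (take k q) (prefix (take k q) (subst (IsPath G) (sym (take++drop≡id k q)) pq))
                (trans (length-take k q) (m≤n⇒m⊓n≡m k≤)))
  ... | w , w∈ , wS = contradiction (trans (sym ([]=⇒lookup wS)) (out w (subst (w ∈_) (take++drop≡id k q) (∈-++⁺ˡ w∈)))) λ ()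

  cover-intro : ∀ {S} → (∀ q → IsPath G q → length q ≡ k → (∀ w → w ∈ q → lookup S w ≡ false) → ⊥) → Cover S
  cover-intro {S} hit q pq len with any? (λ w → lookup S w Bool.≟ true) q
  ... | yes h = Any.map (λ {w} → lookup⇒[]= w S) h
  ... | no ¬h = ⊥-elim (hit q pq len (λ w w∈ → Bool.¬-not (λ eq → ¬h (lose w∈ eq))))

  record Jump (S : Subset n) (x y : Fin n) (S′ : Subset n) : Set where
    field
      source  : lookup S x ≡ true
      target  : lookup S y ≡ false
      result  : S′ ≡ move S x y
      covers′ : Cover S′

  infixl 5 _▷_

  -- The last jump comes first in the list.
  data Run (I : Subset n) : List (Fin n × Fin n) → Subset n → Set where
    start : Cover I → Run I [] I
    _▷_   : ∀ {l S x y S′} → Run I l S → Jump S x y S′ → Run I ((x , y) ∷ l) S′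

  run-cover : ∀ {I l S} → Run I l S → Cover S
  run-cover (start c) = c
  run-cover (_ ▷ j)   = Jump.covers′ j

-- Heights, cut vertices, and why the cut vertices form a cover.

module Sweep {n : ℕ} {G : Graph n} (L : AdjacencyLists G) (k : ℕ) (2≤k : 2 ≤ k) where
  open Paths G
  open Traversal L
  open Runs k G

  -- Updates the height `H` of a vertex by the height `h` returned from a child. The value `k` is
  -- absorbing and stands for a path that is long enough; `H <ᵇ (k ∸ h)` is `H + h < k` in a form
  -- that needs no addition.
  comb : ℕ → ℕ → ℕ
  comb H h = if H <ᵇ (k ∸ h) then (if h <ᵇ H then H else suc h) else k

  -- Height `k` means that the vertex is cut off, so its branch adds nothing to the paths of its
  -- parent.
  ret : ℕ → ℕ
  ret H = if H ≡ᵇ k then 0 else H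

  -- The number of vertices on a longest downward path from v that meets no cut
  -- vertex, or k if the cut-free part below v contains a k-path through v.
  scanH : ∀ {p v us} → Trav p v us → ℕ → ℕ
  scanH []           H = H
  scanH (skip _ t)   H = scanH t H
  scanH (down _ _ c t) H = scanH t (comb H (ret (scanH c 1)))

  tall : ∀ {p v us} → Trav p v us → ℕ
  tall t = scanH t 1

  data Cut : ∀ {p v us} → Trav p v us → Fin n → Set where
    here  : ∀ {p v u us ne e c} {t : Trav p v us} → tall c ≡ k → Cut (down {u = u} ne e c t) u
    inner : ∀ {p v u us ne e c w} {t : Trav p v us} → Cut c w → Cut (down {u = u} ne e c t) w
    outer : ∀ {p v u us ne e c w} {t : Trav p v us} → Cut t w → Cut (down {u = u} ne e c t) w
    skip  : ∀ {p v u us e w} {t : Trav p v us} → Cut t w → Cut (skip {u = u} e t) w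

  cut-∈ : ∀ {p v us w} {t : Trav p v us} → Cut t w → w ∈ verts t
  cut-∈ (here _) = here refl
  cut-∈ (inner {u = u} {c = c} x) = ∈-++⁺ˡ {xs = u ∷ verts c} (there (cut-∈ x))
  cut-∈ (outer {u = u} {c = c} x) = ∈-++⁺ʳ (u ∷ verts c) (cut-∈ x)
  cut-∈ (skip x) = cut-∈ x

  sub-cut : ∀ {p v us u c} {t : Trav p v us} → Sub t u c → tall c ≡ k → Cut t u
  sub-cut here      eq = here eq
  sub-cut (there s) eq = outer (sub-cut s eq)
  sub-cut (skip s)  eq = skip (sub-cut s eq)

  sub-cut′ : ∀ {p v us u c w} {t : Trav p v us} → Sub t u c → Cut c w → Cut t w
  sub-cut′ here      x = inner x
  sub-cut′ (there s) x = outer (sub-cut′ s x)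
  sub-cut′ (skip s)  x = skip (sub-cut′ s x)

  -- The cases of `comb` come in two forms: here the Boolean tests on which the machine branches,
  -- and in `Comb` the inequalities that path lengths require.
  data CombTests (H h : ℕ) : ℕ → Set where
    flag : (H <ᵇ (k ∸ h)) ≡ false → CombTests H h k
    keep : (H <ᵇ (k ∸ h)) ≡ true → (h <ᵇ H) ≡ true → CombTests H h H
    grow : (H <ᵇ (k ∸ h)) ≡ true → (h <ᵇ H) ≡ false → CombTests H h (suc h)

  comb-tests : ∀ H h → CombTests H h (comb H h)
  comb-tests H h with H <ᵇ (k ∸ h) in eq
  ... | false = flag eq
  ... | true with h <ᵇ H in eq′
  ...   | true  = keep eq eq′
  ...   | false = grow eq eq′

  data Comb (H h : ℕ) : ℕ → Set where
    flag : k ≤ H + h → Comb H h k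
    keep : H + h < k → h < H → Comb H h H
    grow : H + h < k → H ≤ h → Comb H h (suc h)

  comb-view : ∀ H h → Comb H h (comb H h)
  comb-view H h with comb H h | comb-tests H h
  ... | _ | flag t   = flag (≮⇒≥ (λ H+h<k → subst T t (<⇒<ᵇ (m+n≤o⇒m≤o∸n (suc H) H+h<k))))
  ... | _ | keep t u = keep (<∸⇒+< (<ᵇ⇒< H (k ∸ h) (subst T (sym t) tt))) (<ᵇ⇒< h H (subst T (sym u) tt))
  ... | _ | grow t u = grow (<∸⇒+< (<ᵇ⇒< H (k ∸ h) (subst T (sym t) tt))) (≮⇒≥ (λ h<H → subst T u (<⇒<ᵇ h<H)))

  comb-<k : ∀ {H h} → comb H h < k → H + h < k × H ≤ comb H h × suc h ≤ comb H h
  comb-<k {H} {h} lt with comb H h | comb-view H h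
  ... | _ | flag _    = ⊥-elim (<-irrefl refl lt)
  ... | _ | keep a b  = a , ≤-refl , b
  ... | _ | grow a b  = a , ≤-trans b (n≤1+n h) , ≤-refl

  comb-≤k : ∀ {H h} → H ≤ k → comb H h ≤ k
  comb-≤k {H} {h} H≤k with comb H h | comb-view H h
  ... | _ | flag _   = ≤-refl
  ... | _ | keep _ _ = H≤k
  ... | _ | grow a _ = ≤-trans (s≤s (m≤n+m h H)) a

  scanH-≤k : ∀ {p v us} (t : Trav p v us) {H} → H ≤ k → scanH t H ≤ k
  scanH-≤k []             H≤k = H≤k
  scanH-≤k (skip _ t)     H≤k = scanH-≤k t H≤k
  scanH-≤k (down _ _ c t) {H} H≤k = scanH-≤k t (comb-≤k {H} {ret (tall c)} H≤k)

  tall-≤k : ∀ {p v us} (t : Trav p v us) → tall t ≤ k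
  tall-≤k t = scanH-≤k t (<⇒≤ 2≤k)

  scanH-mono : ∀ {p v us} (t : Trav p v us) {H} → scanH t H < k → H ≤ scanH t H
  scanH-mono []             lt = ≤-refl
  scanH-mono (skip _ t)     lt = scanH-mono t lt
  scanH-mono (down _ _ c t) {H} lt =
    ≤-trans (proj₁ (proj₂ (comb-<k {H} {ret (tall c)} (≤-<-trans (scanH-mono t lt) lt)))) (scanH-mono t lt)

  ret-tall : ∀ {H} → H < k → ret H ≡ H
  ret-tall {H} lt with H ≡ᵇ k in eq
  ... | false = refl
  ... | true  = ⊥-elim (<⇒≢ lt (≡ᵇ⇒≡ H k (subst T (sym eq) tt)))

  one-branch : ∀ {p v us u c} {t : Trav p v us} → Sub t u c → ∀ {H} → scanH t H < k →
               suc (ret (tall c)) ≤ scanH t H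
  one-branch {t = down _ _ c t} here {H} lt =
    ≤-trans (proj₂ (proj₂ (comb-<k {H} {ret (tall c)} (≤-<-trans (scanH-mono t lt) lt)))) (scanH-mono t lt)
  one-branch (there s) lt = one-branch s lt
  one-branch (skip s)  lt = one-branch s lt

  branch-fits : ∀ {p v us u c} {t : Trav p v us} → Sub t u c → ∀ {H} → scanH t H < k →
                H + ret (tall c) < k
  branch-fits {t = down _ _ c t} here {H} lt =
    proj₁ (comb-<k {H} {ret (tall c)} (≤-<-trans (scanH-mono t lt) lt))
  branch-fits {c = c} {t = down _ _ c′ t} (there s) {H} lt =
    ≤-<-trans (+-monoˡ-≤ (ret (tall c)) (proj₁ (proj₂ (comb-<k {H} {ret (tall c′)} (≤-<-trans (scanH-mono t lt) lt)))))
      (branch-fits s lt)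
  branch-fits (skip s) lt = branch-fits s lt

  -- The branch scanned first has raised the current height to at least one more than its own, and
  -- the second one passes the test against that height. This bounds the paths that bend at `v`.
  two-branches : ∀ {p v us u c u′ c′} {t : Trav p v us} → Sub t u c → Sub t u′ c′ → u ≢ u′ →
                 ∀ {H} → scanH t H < k → suc (ret (tall c) + ret (tall c′)) < k
  two-branches here here ne _ = ⊥-elim (ne refl)
  two-branches {c = c} {c′ = c′} {t = down _ _ _ t} here (there s) ne {H} lt =
    ≤-<-trans (+-monoˡ-≤ (ret (tall c′)) (proj₂ (proj₂ (comb-<k {H} {ret (tall c)} (≤-<-trans (scanH-mono t lt) lt)))))
      (branch-fits s lt)
  two-branches {c = c} {c′ = c′} {t = down _ _ _ t} (there s) here ne {H} lt =
    subst (_< k) (cong suc (+-comm (ret (tall c′)) (ret (tall c))))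
      (≤-<-trans (+-monoˡ-≤ (ret (tall c)) (proj₂ (proj₂ (comb-<k {H} {ret (tall c′)} (≤-<-trans (scanH-mono t lt) lt)))))
        (branch-fits s lt))
  two-branches (there s) (there s′) ne lt = two-branches s s′ ne lt
  two-branches (skip s) (skip s′) ne lt = two-branches s s′ ne lt

  module _ (S : Subset n) where

    Avoids : List (Fin n) → Set
    Avoids q = ∀ w → w ∈ q → lookup S w ≡ false

    CutsIn : ∀ {p v us} → Trav p v us → Set
    CutsIn t = ∀ w → Cut t w → lookup S w ≡ true

    -- `from-top` bounds descending paths and is what the parent of `v` uses; `anywhere` is the
    -- bound in demand. Its last premise lets the statement serve for a cut vertex `v` too, which
    -- lies on no avoiding path once it carries a token.
    record Short {p v us} (t : Trav p v us) : Set where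
      field
        from-top : ∀ q → IsPath G (v ∷ q) → (∀ w → w ∈ q → w ∈ verts t) → Avoids q → tall t < k →
                   length (v ∷ q) ≤ tall t
        anywhere : ∀ q → IsPath G q → (∀ w → w ∈ q → w ∈ v ∷ verts t) → Avoids q →
                   (v ∈ q → tall t < k) → length q < k

    avoided-tall : ∀ {p v us u c} {t : Trav p v us} → CutsIn t → Sub t u c →
                   lookup S u ≡ false → tall c < k
    avoided-tall {c = c} cuts s out = ≤∧≢⇒< (tall-≤k c)
      (λ eq → contradiction (trans (sym (cuts _ (sub-cut s eq))) out) λ ())

    -- A path that misses `v` lies in one branch, where induction applies. A path through `v` has at
    -- most two arms, descending into different branches, and the scan would have set the height to
    -- `k` if they were too long together.
    short : ∀ {p v us} (t : Trav p v us) → Unique (v ∷ verts t) → CutsIn t → Short t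
    short = sub-ind (λ {_} {v} t → Unique (v ∷ verts t) → CutsIn t → Short t) step
      where
      step : ∀ {p v us} (t : Trav p v us) →
             (∀ {u c} → Sub t u c → Unique (u ∷ verts c) → CutsIn c → Short c) →
             Unique (v ∷ verts t) → CutsIn t → Short t
      step {v = v} t IH (v∉′ ∷ un) cuts = record { from-top = from-top ; anywhere = anywhere }
        where
        v∉ : v ∉ verts t
        v∉ = ∉All v∉′

        sub-short : ∀ {u c} → Sub t u c → Short c
        sub-short s = IH s (sub-unique s un) (λ w → cuts w ∘ sub-cut′ s)

        branch : ∀ z q → IsPath G (v ∷ z ∷ q) → (∀ w → w ∈ z ∷ q → w ∈ verts t) → Avoids (z ∷ q) →
                 ∃[ c ] Sub t z c × length (z ∷ q) ≤ ret (tall c)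
        branch z q (e ∷ l , _ ∷ z∉ ∷ uq) q⊆ out with locate t v∉ l q⊆
        ... | u , c , s , q⊆u with q⊆u z (here refl)
        ...   | there z∈ = ⊥-elim (v∉ (sub-⊆ s (closed-forest c z∈ (adj-sym e))))
        ...   | here refl = c , s , subst (length (z ∷ q) ≤_) (sym (ret-tall lt))
                  (Short.from-top (sub-short s) q (l , z∉ ∷ uq) below (λ w → out w ∘ there) lt)
          where
          lt : tall c < k
          lt = avoided-tall cuts s (out z (here refl))
          below : ∀ w → w ∈ q → w ∈ verts c
          below w w∈ with q⊆u w (there w∈)
          ... | here refl = ⊥-elim (∉All z∉ w∈)
          ... | there w∈c = w∈c

        from-top : ∀ q → IsPath G (v ∷ q) → (∀ w → w ∈ q → w ∈ verts t) → Avoids q → tall t < k →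
                   length (v ∷ q) ≤ tall t
        from-top []      _  _  _   lt = scanH-mono t lt
        from-top (z ∷ q) pq q⊆ out lt with branch z q pq q⊆ out
        ... | c , s , le = ≤-trans (s≤s le) (one-branch s lt)

        drop-top : ∀ {q} → (∀ w → w ∈ q → w ∈ v ∷ verts t) → v ∉ q → ∀ w → w ∈ q → w ∈ verts t
        drop-top q⊆ v∉q w w∈ with q⊆ w w∈
        ... | here refl = ⊥-elim (v∉q w∈)
        ... | there w∈t = w∈t

        anywhere : ∀ q → IsPath G q → (∀ w → w ∈ q → w ∈ v ∷ verts t) → Avoids q →
                   (v ∈ q → tall t < k) → length q < k
        anywhere [] _ _ _ _ = <-trans z<s 2≤k
        anywhere q@(x ∷ q′) pq q⊆ out lt with any? (v Fin.≟_) q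
        ... | no v∉q with locate t v∉ (proj₁ pq) (drop-top q⊆ v∉q)
        ...   | u , c , s , q⊆u =
          Short.anywhere (sub-short s) q pq q⊆u out (λ u∈ → avoided-tall cuts s (out u u∈))
        anywhere q@(x ∷ q′) pq q⊆ out lt | yes v∈q
          with split q pq (λ w w∈ → q⊆ w w∈ , out w w∈) v∈q
        ... | record { left = l ; right = r ; left-path = pl ; right-path = pr ; disjoint = dis
                     ; lengths = len ; left-⊆ = l⊆ ; right-⊆ = r⊆ } =
          subst (_< k) len (sides l r pl pr dis l⊆ r⊆)
          where
          Q : Fin n → Set
          Q w = w ∈ v ∷ verts t × lookup S w ≡ false
          low : ∀ {q} → IsPath G (v ∷ q) → (∀ w → w ∈ q → Q w) → ∀ w → w ∈ q → w ∈ verts t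
          low (_ , un) q⊆ = drop-top (λ w → proj₁ ∘ q⊆ w) (head∉tail un)
          sides : ∀ l r → IsPath G (v ∷ l) → IsPath G (v ∷ r) → (∀ w → w ∈ l → w ∉ r) →
                  (∀ w → w ∈ l → Q w) → (∀ w → w ∈ r → Q w) → length l + suc (length r) < k
          sides [] r pl pr dis l⊆ r⊆ =
            ≤-<-trans (from-top r pr (low pr r⊆) (λ w → proj₂ ∘ r⊆ w) (lt v∈q)) (lt v∈q)
          sides l@(_ ∷ _) [] pl pr dis l⊆ r⊆ =
            subst (_< k) (+-comm 1 (length l))
              (≤-<-trans (from-top l pl (low pl l⊆) (λ w → proj₂ ∘ l⊆ w) (lt v∈q)) (lt v∈q))
          sides (z ∷ l) (z′ ∷ r) pl pr dis l⊆ r⊆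
            with branch z l pl (low pl l⊆) (λ w → proj₂ ∘ l⊆ w)
               | branch z′ r pr (low pr r⊆) (λ w → proj₂ ∘ r⊆ w)
          -- The arms are disjoint, so their first vertices are two different children of `v`.
          ... | c , s , le | c′ , s′ , le′ =
            ≤-<-trans (≤-trans (≤-reflexive (+-suc (length (z ∷ l)) (length (z′ ∷ r)))) (s≤s (+-mono-≤ le le′)))
              (two-branches s s′ (λ { refl → dis z (here refl) (here refl) }) (lt v∈q))

    cuts-cover : ∀ {p v} (t : Trav p v (nbrs L v)) → Unique (v ∷ verts t) → CutsIn t →
                 (tall t ≡ k → lookup S v ≡ true) → (∀ w → w ∈ v ∷ verts t) → Cover S
    cuts-cover {v = v} t un cuts top all = cover-intro (λ q pq len out →
      <⇒≢ (Short.anywhere (short t un cuts) q pq (λ w _ → all w) out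
             (λ v∈ → ≤∧≢⇒< (tall-≤k t) (λ eq → contradiction (trans (sym (top eq)) (out v v∈)) λ ()))) len)

-- Gathering tokens at the cut vertices.

record Progress (n : ℕ) : Set where
  constructor progress
  field
    cover : Subset n
    token : Maybe (Fin n)
    jumps : List (Fin n × Fin n)

module Collect {n : ℕ} {G : Graph n} (L : AdjacencyLists G) (k : ℕ) (2≤k : 2 ≤ k) where
  open Progress
  open Paths G
  open Traversal L
  open Runs k G
  open Sweep L k 2≤k

  enter : Fin n → Subset n → Maybe (Fin n)
  enter u S = if lookup S u then just u else nothing

  enter-just : ∀ {u x} S → enter u S ≡ just x → lookup S x ≡ true × x ≡ u
  enter-just {u} S eq with lookup S u in e
  enter-just S refl | true = e , refl

  enter-nothing : ∀ {u} S → enter u S ≡ nothing → lookup S u ≡ false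
  enter-nothing {u} S eq with lookup S u
  enter-nothing S eq | false = refl

  -- One token per uncut part is enough, so a token brought back from a branch replaces the one in
  -- hand.
  join : Maybe (Fin n) → Maybe (Fin n) → Maybe (Fin n)
  join τ nothing  = τ
  join _ (just x) = just x

  -- The token in hand is dropped in every case, so that none that holds a cut vertex is moved
  -- again. The clause that finds neither a token on `u` nor one in hand does not occur for a cover:
  -- `Good.path` would give a missed `k`-path.
  settle : Fin n → Bool → Progress n → Progress n
  settle u true  (progress S _        l) = progress S nothing l
  settle u false (progress S nothing  l) = progress S nothing l
  settle u false (progress S (just x) l) = progress (move S x u) nothing ((x , u) ∷ l)

  leave : Fin n → ℕ → Progress n → Progress n
  leave u H o = if H ≡ᵇ k then settle u (lookup (cover o) u) o else o

  descendInto : Fin n → Progress n → Progress n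
  descendInto u o = record o { token = enter u (cover o) }

  -- While a child is explored, the parent's token `τ` waits outside the progress record; on the
  -- machine it waits in the parent's stack frame.
  returnTo : Maybe (Fin n) → Progress n → Progress n
  returnTo τ o = record o { token = join τ (token o) }

  scanS : ∀ {p v us} → Trav p v us → Progress n → Progress n
  scanS []                   o = o
  scanS (skip _ t)           o = scanS t o
  scanS (down {u = u} _ _ c t) o =
    scanS t (returnTo (token o) (leave u (tall c) (scanS c (descendInto u o))))

  visitS : ∀ {p u} → Trav p u (nbrs L u) → Progress n → Progress n
  visitS {u = u} c o = leave u (tall c) (scanS c (descendInto u o))

  settle-jumps : ∀ u b o → length (jumps (settle u b o)) ≤ suc (length (jumps o))
  settle-jumps u true  (progress S _        l) = n≤1+n _
  settle-jumps u false (progress S nothing  l) = n≤1+n _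
  settle-jumps u false (progress S (just x) l) = ≤-refl

  leave-jumps : ∀ u H o → length (jumps (leave u H o)) ≤ suc (length (jumps o))
  leave-jumps u H o with H ≡ᵇ k
  ... | false = n≤1+n _
  ... | true  = settle-jumps u (lookup (cover o) u) o

  scanS-jumps : ∀ {p v us} (t : Trav p v us) o → length (jumps (scanS t o)) ≤ length (verts t) + length (jumps o)
  scanS-jumps []                   o = ≤-refl
  scanS-jumps (skip _ t)           o = scanS-jumps t o
  scanS-jumps (down {u = u} _ _ c t) o =
    ≤-trans (scanS-jumps t _)
      (≤-trans (+-monoʳ-≤ (size t) (≤-trans (leave-jumps u (tall c) _) (s≤s (scanS-jumps c _))))
        (≤-reflexive (trans (cong (size t +_) (cong suc refl))
          (trans (sym (+-assoc (size t) (suc (size c)) (length (jumps o))))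
            (cong (_+ length (jumps o)) (trans (+-comm (size t) (suc (size c))) (sym (length-++ (u ∷ verts c)))))))))

  -- `D` is the part explored so far. With no token in hand, the height `H` is backed by an actual
  -- path that avoids the cover, which keeps `H` below `k`.
  record Good (v : Fin n) (D : Fin n → Set) (H : ℕ) (o : Progress n) : Set where
    field
      tok  : ∀ {x} → token o ≡ just x → lookup (cover o) x ≡ true × D x
      path : token o ≡ nothing → ∃[ r ] IsPath G (v ∷ r) × (∀ w → w ∈ v ∷ r → D w) ×
             Avoids (cover o) (v ∷ r) × length (v ∷ r) ≡ H

  -- `frame` confines the changes to the part just scanned, and the second half of `cuts` ensures
  -- that the next move takes no token off a cut vertex.
  record Settled (D : Fin n → Set) (C : Fin n → Set) (o o′ : Progress n) : Set where
    field
      frame : ∀ w → ¬ D w → lookup (cover o′) w ≡ lookup (cover o) w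
      cuts  : ∀ w → C w → lookup (cover o′) w ≡ true × token o′ ≢ just w

  -- The alternative `q ≡ []` is for a `u` that has been cut, whose returned height is 0.
  record Visited (u : Fin n) (D : Fin n → Set) (h : ℕ) (o : Progress n) : Set where
    field
      tok  : ∀ {x} → token o ≡ just x → lookup (cover o) x ≡ true × D x
      path : token o ≡ nothing → ∃[ q ] IsPath G q × (∀ w → w ∈ q → D w) × Avoids (cover o) q ×
             length q ≡ h × (q ≡ [] ⊎ ∃[ r ] q ≡ u ∷ r)

  CutAt : ∀ {p u us} → Trav p u us → Fin n → Set
  CutAt {u = u} c w = Cut c w ⊎ (w ≡ u × tall c ≡ k)

  -- The token moved to a cut vertex u leaves a cover: a path that it alone hit
  -- avoids u and the cut vertices below u, hence stays below u and is short.
  move-cover : ∀ {p u x S} (c : Trav p u (nbrs L u)) → Unique (u ∷ verts c) → Cover S →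
               lookup S u ≡ false → lookup S x ≡ true → x ∈ u ∷ verts c →
               (∀ w → Cut c w → lookup S w ≡ true × x ≢ w) → Cover (move S x u)
  move-cover {u = u} {x} {S} c un cov uS xS x∈ cuts = cover-intro hit
    where
    S′ = move S x u
    x≢u : x ≢ u
    x≢u refl = contradiction (trans (sym xS) uS) λ ()
    x∈c : x ∈ u ∷ verts c → x ∈ verts c
    x∈c (here eq)  = ⊥-elim (x≢u eq)
    x∈c (there x∈) = x∈
    cuts′ : CutsIn S′ c
    cuts′ w cw with w Fin.≟ u
    ... | yes refl = move-target S x u
    ... | no w≢u   = trans (move-other S (proj₂ (cuts w cw) ∘ sym) w≢u) (proj₁ (cuts w cw))
    hit : ∀ q → IsPath G q → length q ≡ k → Avoids S′ q → ⊥
    hit q pq len out with any? (x Fin.≟_) q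
    ... | no x∉ = cover-hits cov pq (≤-reflexive (sym len)) λ w w∈ →
            trans (sym (move-other S (λ { refl → x∉ w∈ }) (λ { refl → u∉ w∈ }))) (out w w∈)
      where
      u∉ : u ∉ q
      u∉ u∈ = contradiction (trans (sym (move-target S x u)) (out u u∈)) λ ()
    ... | yes x∈q = <⇒≢ (Short.anywhere (short S′ c un cuts′) q pq
                          (λ w w∈ → there (trapped c q (proj₁ pq) u∉ x∈q (x∈c x∈) w w∈)) out
                          (λ u∈ → ⊥-elim (u∉ u∈))) len
      where
      u∉ : u ∉ q
      u∉ u∈ = contradiction (trans (sym (move-target S x u)) (out u u∈)) λ ()

  module _ {I : Subset n} where

    Reaches : Progress n → Set
    Reaches o = Run I (jumps o) (cover o)

    leave-good : ∀ {p u} (c : Trav p u (nbrs L u)) {o₀ o} → Unique (u ∷ verts c) →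
      Reaches o → Good u (_∈ u ∷ verts c) (tall c) o → Settled (_∈ verts c) (Cut c) o₀ o →
      let o′ = leave u (tall c) o in
      Reaches o′ × Visited u (_∈ u ∷ verts c) (ret (tall c)) o′ × Settled (_∈ u ∷ verts c) (CutAt c) o₀ o′
    leave-good {u = u} c {o₀} {o} un run good st with tall c ≡ᵇ k in eq
    ... | false = run
        , record
          { tok = Good.tok good
          ; path = λ e → let (r , p , d , a , len) = Good.path good e in
                         u ∷ r , p , d , a , len , inj₂ (r , refl) }
        , record
          { frame = λ w w∉ → Settled.frame st w (w∉ ∘ there)
          ; cuts = λ { w (inj₁ cw) → Settled.cuts st w cw
                     ; w (inj₂ (_ , e)) → ⊥-elim (subst T eq (≡⇒≡ᵇ _ _ e)) } }
    ... | true = settled (lookup (cover o) u) refl o refl run good st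
      where
      tall≡k : tall c ≡ k
      tall≡k = ≡ᵇ⇒≡ _ _ (subst T (sym eq) tt)
      settled : ∀ b → lookup (cover o) u ≡ b → ∀ o₁ → o₁ ≡ o →
        Reaches o₁ → Good u (_∈ u ∷ verts c) (tall c) o₁ → Settled (_∈ verts c) (Cut c) o₀ o₁ →
        let o′ = settle u b o₁ in
        Reaches o′ × Visited u (_∈ u ∷ verts c) 0 o′ × Settled (_∈ u ∷ verts c) (CutAt c) o₀ o′
      settled true uS (progress S _ l) refl run good st = run
        , record { tok = λ () ; path = λ _ → [] , ([] , []) , (λ _ ()) , (λ _ ()) , refl , inj₁ refl }
        , record { frame = λ w w∉ → Settled.frame st w (w∉ ∘ there)
                 ; cuts = λ { w (inj₁ cw) → proj₁ (Settled.cuts st w cw) , λ ()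
                            ; w (inj₂ (refl , _)) → uS , λ () } }
      -- Height `k` with no token in hand: the path behind the height would be a `k`-path that the
      -- cover misses.
      settled false uS (progress S nothing l) refl run good st with Good.path good refl
      ... | r , p , d , a , len = ⊥-elim (cover-hits (run-cover run) p (≤-reflexive (sym (trans len tall≡k))) a)
      settled false uS (progress S (just x) l) refl run good st = 
          run ▷ record { source = xS ; target = uS ; result = refl
                       ; covers′ = move-cover c un (run-cover run) uS xS x∈
                                     (λ w cw → proj₁ (Settled.cuts st w cw) , λ e → proj₂ (Settled.cuts st w cw) (cong just e)) }
        , record { tok = λ () ; path = λ _ → [] , ([] , []) , (λ _ ()) , (λ _ ()) , refl , inj₁ refl }
        , record { frame = λ w w∉ → trans (move-other S (λ { refl → w∉ x∈ }) (λ { refl → w∉ (here refl) }))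
                                          (Settled.frame st w (w∉ ∘ there))
                 ; cuts = λ { w (inj₁ cw) → cut w cw , λ () ; w (inj₂ (refl , _)) → move-target S x u , λ () } }
        where
        xS = proj₁ (Good.tok good refl)
        x∈ = proj₂ (Good.tok good refl)
        cut : ∀ w → Cut c w → lookup (move S x u) w ≡ true
        cut w cw with w Fin.≟ u
        ... | yes refl = move-target S x u
        ... | no w≢u   = trans (move-other S (λ { refl → proj₂ (Settled.cuts st w cw) refl }) w≢u) (proj₁ (Settled.cuts st w cw))

    join-good : ∀ {p u v D H} (c : Trav p u (nbrs L u)) {o o′} → Adj G v u →
      D v → (∀ w → D w → w ∉ u ∷ verts c) → Good v D H o → Reaches o′ →
      Visited u (_∈ u ∷ verts c) (ret (tall c)) o′ → Settled (_∈ u ∷ verts c) (CutAt c) o o′ →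
      Good v (λ w → D w ⊎ w ∈ u ∷ verts c) (comb H (ret (tall c))) (returnTo (token o) o′)
    join-good {u = u} {v} {D} {H} c {o} {progress S′ (just x) l′} e Dv apart good run vis st = record
      { tok = λ { refl → proj₁ (Visited.tok vis refl) , inj₂ (proj₂ (Visited.tok vis refl)) } ; path = λ () }
    join-good {u = u} {v} {D} {H} c {progress S τ l} {progress S′ nothing l′} e Dv apart good run vis st = record
      { tok = λ { refl → let (xS , Dx) = Good.tok good refl in
                         trans (Settled.frame st _ (apart _ Dx)) xS , inj₁ Dx }
      ; path = λ { refl → paths (Good.path good refl) (Visited.path vis refl) } }
      where
      paths : ∀ {h} → ∃[ r ] IsPath G (v ∷ r) × (∀ w → w ∈ v ∷ r → D w) × Avoids S (v ∷ r) × length (v ∷ r) ≡ H →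
              ∃[ q ] IsPath G q × (∀ w → w ∈ q → w ∈ u ∷ verts c) × Avoids S′ q × length q ≡ h × (q ≡ [] ⊎ ∃[ r ] q ≡ u ∷ r) →
              ∃[ r ] IsPath G (v ∷ r) × (∀ w → w ∈ v ∷ r → D w ⊎ w ∈ u ∷ verts c) × Avoids S′ (v ∷ r) × length (v ∷ r) ≡ comb H h
      paths (r , pr , dr , ar , refl) (q , pq , dq , aq , refl , shape) with comb (length (v ∷ r)) (length q) | comb-view (length (v ∷ r)) (length q)
      ... | _ | keep _ _ = r , pr , (λ w → inj₁ ∘ dr w) , (λ w w∈ → trans (Settled.frame st w (apart w (dr w w∈))) (ar w w∈)) , refl
      ... | _ | grow _ H≤h with shape
      ...   | inj₂ (r′ , refl) = u ∷ r′
              , (e ∷ proj₁ pq , All∉ (λ v∈ → apart v Dv (dq v v∈)) ∷ proj₂ pq)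
              , (λ { w (here refl) → inj₁ Dv ; w (there w∈) → inj₂ (dq w w∈) })
              , (λ { w (here refl) → trans (Settled.frame st v (apart v Dv)) (ar v (here refl)) ; w (there w∈) → aq w w∈ })
              , refl
      -- An empty `q` has length 0, while the height on the other side counts `v` and is positive.
      ...   | inj₁ refl = contradiction H≤h λ ()
      -- `flag` cannot occur without a token: the missed path at `v`, extended by the one at `u` if
      -- that is nonempty, would have at least `k` vertices.
      paths (r , pr , dr , ar , refl) (q , pq , dq , aq , refl , shape) | _ | flag k≤ = ⊥-elim (hit shape)
        where
        ar′ : Avoids S′ (v ∷ r)
        ar′ w w∈ = trans (Settled.frame st w (apart w (dr w w∈))) (ar w w∈)
        hit : q ≡ [] ⊎ ∃[ r′ ] q ≡ u ∷ r′ → ⊥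
        hit (inj₁ refl) = cover-hits (run-cover run) pr (subst (k ≤_) (+-identityʳ _) k≤) ar′
        hit (inj₂ (r′ , refl)) = cover-hits (run-cover run)
          (path-join v r pr pq e (λ w w∈ w∈q → apart w (dr w w∈) (dq w w∈q)))
          (≤-trans k≤ (≤-reflexive (sym (length-ʳ++ (v ∷ r)))))
          (ʳ++-⊆ (v ∷ r) (u ∷ r′) ar′ aq)

    -- A token picked up later is from a later branch, which is disjoint from the earlier ones.
    -- Hence a cut vertex of an earlier branch cannot come back as the token in hand.
    From : Maybe (Fin n) → List (Fin n) → Maybe (Fin n) → Set
    From τ ws τ′ = ∀ w → τ′ ≡ just w → w ∈ ws ⊎ τ ≡ just w

    scan-good : ∀ {p v us D H} (t : Trav p v us) o → Unique (v ∷ verts t) → D v → (∀ w → D w → w ∉ verts t) →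
      Reaches o → Good v D H o →
      let o′ = scanS t o in
      Reaches o′ × Good v (λ w → D w ⊎ w ∈ verts t) (scanH t H) o′ × Settled (_∈ verts t) (Cut t) o o′ ×
      From (token o) (verts t) (token o′)

    visit-good : ∀ {p u} (c : Trav p u (nbrs L u)) o → Unique (u ∷ verts c) → Reaches o →
      let o′ = visitS c o in
      Reaches o′ × Visited u (_∈ u ∷ verts c) (ret (tall c)) o′ × Settled (_∈ u ∷ verts c) (CutAt c) o o′

    scan-good [] o un Dv apart run good =
      run , record { tok = λ e → let (a , b) = Good.tok good e in a , inj₁ b
                   ; path = λ e → let (r , p , d , rest) = Good.path good e in r , p , (λ w w∈ → inj₁ (d w w∈)) , rest }
      , record { frame = λ _ _ → refl ; cuts = λ _ () } , λ _ → inj₂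
    scan-good (skip _ t) o un Dv apart run good with scan-good t o un Dv apart run good
    ... | run′ , good′ , st , from =
      run′ , good′ , record { frame = Settled.frame st ; cuts = λ { w (skip cw) → Settled.cuts st w cw } } , from
    scan-good {v = v} {D = D} (down {u = u} ne e c t) o (v∉ ∷ un) Dv apart run good
      with visit-good c o (unique-++⁻ˡ (u ∷ verts c) un) run
    ... | run₁ , vis , st₁
      with scan-good t _
             (All∉ (λ v∈ → ∉All v∉ (∈-++⁺ʳ (u ∷ verts c) v∈)) ∷ unique-++⁻ʳ (u ∷ verts c) un)
             (inj₁ Dv)
             (λ { w (inj₁ Dw) w∈ → apart w Dw (∈-++⁺ʳ (u ∷ verts c) w∈)
                ; w (inj₂ w∈c) w∈ → unique-disjoint (u ∷ verts c) un w∈c w∈ })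
             run₁
             (join-good c e Dv (λ w Dw w∈ → apart w Dw (∈-++⁺ˡ w∈)) good run₁ vis st₁)
    ...   | run′ , good′ , st , from =
      run′
      , record { tok = λ eq → let (a , d) = Good.tok good′ eq in a , merge d
               ; path = λ eq → let (r , p , d , rest) = Good.path good′ eq in r , p , (λ w → merge ∘ d w) , rest }
      , record { frame = λ w w∉ → trans (Settled.frame st w (w∉ ∘ ∈-++⁺ʳ (u ∷ verts c))) (Settled.frame st₁ w (w∉ ∘ ∈-++⁺ˡ))
               ; cuts = cuts }
      , from′
      where
      o₁ = visitS c o
      merge : ∀ {w} → (D w ⊎ w ∈ u ∷ verts c) ⊎ w ∈ verts t → D w ⊎ w ∈ (u ∷ verts c) ++ verts t
      merge (inj₁ (inj₁ d))  = inj₁ d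
      merge (inj₁ (inj₂ w∈)) = inj₂ (∈-++⁺ˡ w∈)
      merge (inj₂ w∈)        = inj₂ (∈-++⁺ʳ (u ∷ verts c) w∈)
      joined : ∀ w → join (token o) (token o₁) ≡ just w → token o₁ ≡ just w ⊎ token o ≡ just w
      joined w eq with token o₁
      ... | just _  = inj₁ eq
      ... | nothing = inj₂ eq
      from′ : From (token o) (verts (down ne e c t)) (token (scanS t (returnTo (token o) o₁)))
      from′ w eq with from w eq
      ... | inj₁ w∈ = inj₁ (∈-++⁺ʳ (u ∷ verts c) w∈)
      ... | inj₂ eq′ with joined w eq′
      ...   | inj₁ e₁ = inj₁ (∈-++⁺ˡ (proj₂ (Visited.tok vis e₁)))
      ...   | inj₂ e₂ = inj₂ e₂
      kept : ∀ w → w ∈ u ∷ verts c → CutAt c w →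
             lookup (cover (scanS t (returnTo (token o) o₁))) w ≡ true × token (scanS t (returnTo (token o) o₁)) ≢ just w
      kept w w∈ cw = trans (Settled.frame st w w∉t) (proj₁ (Settled.cuts st₁ w cw)) , no-token
        where
        w∉t = unique-disjoint (u ∷ verts c) un w∈
        no-token : token (scanS t (returnTo (token o) o₁)) ≢ just w
        no-token eq with from w eq
        ... | inj₁ w∈t = w∉t w∈t
        ... | inj₂ eq′ with joined w eq′
        ...   | inj₁ e₁ = proj₂ (Settled.cuts st₁ w cw) e₁
        ...   | inj₂ e₂ = apart w (proj₂ (Good.tok good e₂)) (∈-++⁺ˡ w∈)
      cuts : ∀ w → Cut (down ne e c t) w →
             lookup (cover (scanS t (returnTo (token o) o₁))) w ≡ true × token (scanS t (returnTo (token o) o₁)) ≢ just w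
      cuts w (here eq)  = kept w (here refl) (inj₂ (refl , eq))
      cuts w (inner cw) = kept w (there (cut-∈ cw)) (inj₁ cw)
      cuts w (outer cw) = Settled.cuts st w cw

    visit-good {u = u} c o un run
      with scan-good {D = _≡ u} {H = 1} c (descendInto u o) un refl (λ { _ refl → head∉tail un }) run entered
      where
      entered : Good u (_≡ u) 1 (descendInto u o)
      entered = record
        { tok = λ eq → let (a , b) = enter-just (cover o) eq in a , b
        ; path = λ eq → [] , ([-] , [] ∷ []) , (λ { w (here refl) → refl })
                         , (λ { w (here refl) → enter-nothing (cover o) eq }) , refl }
    ... | run′ , good , st , _ =
      leave-good c {o₀ = o} {o = scanS c (descendInto u o)} un run′
        (record { tok = λ e → let (a , d) = Good.tok good e in a , place d
                ; path = λ e → let (r , p , d , rest) = Good.path good e in r , p , (λ w → place ∘ d w) , rest })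
        (record { frame = Settled.frame st ; cuts = Settled.cuts st })
      where
      place : ∀ {w} → w ≡ u ⊎ w ∈ verts c → w ∈ u ∷ verts c
      place (inj₁ eq) = here eq
      place (inj₂ w∈) = there w∈

-- Subsets that differ by one move.

subset-ext : ∀ {n} {p q : Subset n} → (∀ w → lookup p w ≡ lookup q w) → p ≡ q
subset-ext {p = p} {q} eq = trans (sym (tabulate∘lookup p)) (trans (tabulate-cong eq) (tabulate∘lookup q))

lookup-─ : ∀ {n} (p q : Subset n) w → lookup (p ─ q) w ≡ lookup p w ∧ not (lookup q w)
lookup-─ (false ∷ p) (true ∷ q)  zero = refl
lookup-─ (true ∷ p)  (true ∷ q)  zero = refl
lookup-─ (false ∷ p) (false ∷ q) zero = refl
lookup-─ (true ∷ p)  (false ∷ q) zero = refl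
lookup-─ (_ ∷ p) (true ∷ q)  (suc w) = lookup-─ p q w
lookup-─ (_ ∷ p) (false ∷ q) (suc w) = lookup-─ p q w

lookup-⁅x⁆-x : ∀ {n} (x : Fin n) → lookup ⁅ x ⁆ x ≡ true
lookup-⁅x⁆-x zero    = refl
lookup-⁅x⁆-x (suc x) = lookup-⁅x⁆-x x

lookup-⁅x⁆ : ∀ {n} {x w : Fin n} → w ≢ x → lookup ⁅ x ⁆ w ≡ false
lookup-⁅x⁆ {x = zero}  {zero}  ne = ⊥-elim (ne refl)
lookup-⁅x⁆ {x = zero}  {suc w} ne = lookup-replicate w false
lookup-⁅x⁆ {x = suc x} {zero}  ne = refl
lookup-⁅x⁆ {x = suc x} {suc w} ne = lookup-⁅x⁆ (ne ∘ cong suc)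

-- Both sides count the union of `p` and `q`.
∣p∣+∣q─p∣ : ∀ {n} (p q : Subset n) → ∣ p ∣ + ∣ q ─ p ∣ ≡ ∣ q ∣ + ∣ p ─ q ∣
∣p∣+∣q─p∣ [] [] = refl
∣p∣+∣q─p∣ (true ∷ p)  (true ∷ q)  = cong suc (∣p∣+∣q─p∣ p q)
∣p∣+∣q─p∣ (true ∷ p)  (false ∷ q) = trans (cong suc (∣p∣+∣q─p∣ p q)) (sym (+-suc _ _))
∣p∣+∣q─p∣ (false ∷ p) (true ∷ q)  = trans (+-suc _ _) (cong suc (∣p∣+∣q─p∣ p q))
∣p∣+∣q─p∣ (false ∷ p) (false ∷ q) = ∣p∣+∣q─p∣ p q

exchange-card : ∀ {n} {p q : Subset n} {x y} → p ─ q ≡ ⁅ x ⁆ → q ─ p ≡ ⁅ y ⁆ → ∣ p ∣ ≡ ∣ q ∣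
exchange-card {p = p} {q} {x} {y} e e′ = +-cancelʳ-≡ 1 _ _
  (trans (cong (∣ p ∣ +_) (sym (trans (cong ∣_∣ e′) (∣⁅x⁆∣≡1 y))))
    (trans (∣p∣+∣q─p∣ p q) (cong (∣ q ∣ +_) (trans (cong ∣_∣ e) (∣⁅x⁆∣≡1 x)))))

module _ {n : ℕ} (S : Subset n) (x y : Fin n) (xS : lookup S x ≡ true) (yS : lookup S y ≡ false) where

  private
    x≢y : x ≢ y
    x≢y refl = contradiction (trans (sym xS) yS) λ ()

  move-removed : S ─ move S x y ≡ ⁅ x ⁆
  move-removed = subset-ext λ w → trans (lookup-─ S (move S x y) w) (at w)
    where
    at : ∀ w → lookup S w ∧ not (lookup (move S x y) w) ≡ lookup ⁅ x ⁆ w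
    at w with w Fin.≟ x | w Fin.≟ y
    ... | yes refl | _ = trans (cong₂ (λ a b → a ∧ not b) xS (move-source S x≢y)) (sym (lookup-⁅x⁆-x x))
    ... | no w≢x | yes refl = trans (cong (_∧ not (lookup (move S x y) y)) yS) (sym (lookup-⁅x⁆ w≢x))
    ... | no w≢x | no w≢y = trans (cong (λ b → lookup S w ∧ not b) (move-other S w≢x w≢y))
                              (trans (Bool.∧-inverseʳ (lookup S w)) (sym (lookup-⁅x⁆ w≢x)))

  move-added : move S x y ─ S ≡ ⁅ y ⁆
  move-added = subset-ext λ w → trans (lookup-─ (move S x y) S w) (at w)
    where
    at : ∀ w → lookup (move S x y) w ∧ not (lookup S w) ≡ lookup ⁅ y ⁆ w
    at w with w Fin.≟ x | w Fin.≟ y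
    ... | _ | yes refl = trans (cong₂ (λ a b → a ∧ not b) (move-target S x y) yS) (sym (lookup-⁅x⁆-x y))
    ... | yes refl | no w≢y = trans (cong (_∧ not (lookup S x)) (move-source S x≢y)) (sym (lookup-⁅x⁆ w≢y))
    ... | no w≢x | no w≢y = trans (cong (_∧ not (lookup S w)) (move-other S w≢x w≢y))
                              (trans (Bool.∧-inverseʳ (lookup S w)) (sym (lookup-⁅x⁆ w≢y)))

  move-card : ∣ move S x y ∣ ≡ ∣ S ∣
  move-card = sym (exchange-card move-removed move-added)

  move-back : move (move S x y) y x ≡ S
  move-back = subset-ext at
    where
    at : ∀ w → lookup (move (move S x y) y x) w ≡ lookup S w
    at w with w Fin.≟ x | w Fin.≟ y
    ... | yes refl | _ = trans (move-target (move S x y) y x) (sym xS)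
    ... | no w≢x | yes refl = trans (move-source (move S x y) (x≢y ∘ sym)) (sym yS)
    ... | no w≢x | no w≢y = trans (move-other (move S x y) w≢y w≢x) (move-other S w≢x w≢y)

  moved-out : lookup (move S x y) x ≡ false
  moved-out = move-source S x≢y

-- From runs to sequences: reversing runs and exchanging differences.

record Lists {n} (xs : List (Fin n)) (A B : Subset n) : Set where
  field
    unique   : Unique xs
    sound    : ∀ {w} → w ∈ xs → lookup A w ≡ true × lookup B w ≡ false
    complete : ∀ {w} → lookup A w ≡ true → lookup B w ≡ false → w ∈ xs

-- The list is stored backwards: its last element is at index 0.
Holds : (ℕ → ℕ) → List ℕ → Set
Holds f []       = ⊤
Holds f (x ∷ xs) = f (length xs) ≡ x × Holds f xs

holds-ʳ++ : ∀ {A : Set} {f} (g : A → ℕ) l r → Holds f (map g l) →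
            (∀ (j : Fin (length r)) → f (length l + toℕ j) ≡ g (List.lookup r j)) →
            ∀ (j : Fin (length (l ʳ++ r))) → f (toℕ j) ≡ g (List.lookup (l ʳ++ r) j)
holds-ʳ++ g []      r h        hr = hr
holds-ʳ++ {f = f} g (a ∷ l) r (fa , h) hr = holds-ʳ++ g l (a ∷ r) h
  λ { zero    → trans (cong f (trans (+-identityʳ _) (sym (length-map′ l)))) fa
    ; (suc j) → trans (cong f (+-suc (length l) (toℕ j))) (hr j) }
  where
  length-map′ : ∀ l → length (map g l) ≡ length l
  length-map′ []      = refl
  length-map′ (_ ∷ l) = cong suc (length-map′ l)

module Sequences {n : ℕ} (k : ℕ) (G : Graph n) where
  open Runs k G

  -- The first jump is at the head, which is the order in which a `TJSequence` indexes its jumps.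
  data Forward (J : Subset n) : List (Fin n × Fin n) → Subset n → Set where
    stop : Cover J → Forward J [] J
    step : ∀ {l S x y S′} → Cover S → Jump S x y S′ → Forward J l S′ → Forward J ((x , y) ∷ l) S

  forward : ∀ {I J l r S} → Run I l S → Forward J r S → Forward J (l ʳ++ r) I
  forward (start _) f = f
  forward (run ▷ j) f = forward run (step (run-cover run) j f)

  coverAt : ∀ {J l S} → Forward J l S → Fin (suc (length l)) → Subset n
  coverAt {S = S} _ zero    = S
  coverAt (step _ _ f) (suc i) = coverAt f i

  sequence : ∀ {J l S} → Forward J l S → TJSequence k G S J
  sequence {l = l} f = record
    { ℓ = length l
    ; cover = coverAt f
    ; isCover = covers f
    ; start = refl
    ; end = end f
    ; x = proj₁ ∘ List.lookup l
    ; y = proj₂ ∘ List.lookup l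
    ; removed = removed f
    ; added = added f
    }
    where
    covers : ∀ {J l S} (f : Forward J l S) i → Cover (coverAt f i)
    covers (stop c)     zero    = c
    covers (step c _ _) zero    = c
    covers (step _ _ f) (suc i) = covers f i
    end : ∀ {J l S} (f : Forward J l S) → coverAt f (fromℕ (length l)) ≡ J
    end (stop _)     = refl
    end (step _ _ f) = end f
    removed : ∀ {J l S} (f : Forward J l S) i →
              coverAt f (inject₁ i) ─ coverAt f (suc i) ≡ ⁅ proj₁ (List.lookup l i) ⁆
    removed (step _ j f) zero rewrite Jump.result j = move-removed _ _ _ (Jump.source j) (Jump.target j)
    removed (step _ _ f) (suc i) = removed f i
    added : ∀ {J l S} (f : Forward J l S) i →
            coverAt f (suc i) ─ coverAt f (inject₁ i) ≡ ⁅ proj₂ (List.lookup l i) ⁆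
    added (step _ j f) zero rewrite Jump.result j = move-added _ _ _ (Jump.source j) (Jump.target j)
    added (step _ _ f) (suc i) = added f i

  sequence-card : ∀ {I J} → TJSequence k G I J → ∣ I ∣ ≡ ∣ J ∣
  sequence-card S = trans (cong ∣_∣ (sym begins)) (trans (sym (same (fromℕ ℓ))) (cong ∣_∣ end))
    where
    open TJSequence S renaming (start to begins)
    same : ∀ i → ∣ cover i ∣ ≡ ∣ cover zero ∣
    same = <-weakInduction (λ i → ∣ cover i ∣ ≡ ∣ cover zero ∣) refl
      (λ i eq → trans (sym (exchange-card (removed i) (added i))) eq)

  run-card : ∀ {I l S} → Run I l S → ∣ S ∣ ≡ ∣ I ∣
  run-card (start _) = refl
  run-card (_▷_ {S = S} {x} {y} run j) = trans (trans (cong ∣_∣ (Jump.result j)) (move-card S x y (Jump.source j) (Jump.target j))) (run-card run)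

  -- A jump can be undone because the set it started from is a cover too. Source and target change
  -- places, and the last jump is undone first.
  unwind : ∀ {I J l acc S} → Run J l S → Run I acc S → Run I (map swap l ʳ++ acc) J
  unwind (start _) acc = acc
  unwind (_▷_ {S = S₀} run j) acc with Jump.result j
  ... | refl = unwind run (acc ▷ record
    { source  = move-target S₀ _ _
    ; target  = moved-out S₀ _ _ (Jump.source j) (Jump.target j)
    ; result  = sym (move-back S₀ _ _ (Jump.source j) (Jump.target j))
    ; covers′ = run-cover run })

  module _ {C : Fin n → Set} (covering : ∀ S → (∀ w → C w → lookup S w ≡ true) → Cover S) where

    -- Any pairing of sources with targets works, as every set in between contains `C`. The
    -- recursion changes the target and not the start: a run has its last jump at the head, so the
    -- heads `x` and `y` belong to the final jump, from `move S′ y x` to `S′`. If one list ended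
    -- early, one set would be properly contained in the other, against equal cardinality.
    exchange : ∀ {I l S} xs ys S′ → Run I l S → (∀ w → C w → lookup S w ≡ true) →
               (∀ w → C w → lookup S′ w ≡ true) → Lists xs S S′ → Lists ys S′ S → ∣ S ∣ ≡ ∣ S′ ∣ →
               length xs ≡ length ys × Run I (zip xs ys ++ l) S′
    exchange {I} {l} {S} [] [] S′ run CS CS′ X Y card = refl , subst (Run I l) (subset-ext agree) run
      where
      agree : ∀ w → lookup S w ≡ lookup S′ w
      agree w with lookup S w in e | lookup S′ w in e′
      ... | true  | true  = refl
      ... | false | false = refl
      ... | true  | false = contradiction (Lists.complete X e e′) λ ()
      ... | false | true  = contradiction (Lists.complete Y e′ e) λ ()
    exchange {S = S} [] (y ∷ ys) S′ run CS CS′ X Y card = ⊥-elim (<⇒≢ (p⊂q⇒∣p∣<∣q∣ proper) card)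
      where
      proper : S ⊂ S′
      proper = (λ {w} w∈ → lookup⇒[]= w S′ (sub w ([]=⇒lookup w∈)))
             , y , lookup⇒[]= y S′ (proj₁ (Lists.sound Y (here refl)))
             , λ y∈ → contradiction (trans (sym ([]=⇒lookup y∈)) (proj₂ (Lists.sound Y (here refl)))) λ ()
        where
        sub : ∀ w → lookup S w ≡ true → lookup S′ w ≡ true
        sub w wS with lookup S′ w in e
        ... | true  = refl
        ... | false = contradiction (Lists.complete X wS e) λ ()
    exchange {S = S} (x ∷ xs) [] S′ run CS CS′ X Y card = ⊥-elim (<⇒≢ (p⊂q⇒∣p∣<∣q∣ proper) (sym card))
      where
      proper : S′ ⊂ S
      proper = (λ {w} w∈ → lookup⇒[]= w S (sub w ([]=⇒lookup w∈)))
             , x , lookup⇒[]= x S (proj₁ (Lists.sound X (here refl)))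
             , λ x∈ → contradiction (trans (sym ([]=⇒lookup x∈)) (proj₂ (Lists.sound X (here refl)))) λ ()
        where
        sub : ∀ w → lookup S′ w ≡ true → lookup S w ≡ true
        sub w wS with lookup S w in e
        ... | true  = refl
        ... | false = contradiction (Lists.complete Y wS e) λ ()
    exchange {I} {l} {S} (x ∷ xs) (y ∷ ys) S′ run CS CS′ X Y card =
      cong suc (proj₁ IH) , proj₂ IH ▷ record
        { source = move-target S′ y x
        ; target = moved-out S′ y x yS′ xS′
        ; result = sym (move-back S′ y x yS′ xS′)
        ; covers′ = covering S′ CS′ }
      where
      xS  = proj₁ (Lists.sound X (here refl))
      xS′ = proj₂ (Lists.sound X (here refl))
      yS′ = proj₁ (Lists.sound Y (here refl))
      yS  = proj₂ (Lists.sound Y (here refl))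
      S₁ = move S′ y x
      other : ∀ {w} → w ≢ x → w ≢ y → lookup S₁ w ≡ lookup S′ w
      other w≢x w≢y = move-other S′ w≢y w≢x
      differ : ∀ (A : Subset n) {v w} → lookup A v ≡ true → lookup A w ≡ false → v ≢ w
      differ A t f refl = contradiction (trans (sym t) f) λ ()
      drop : ∀ {z zs} {A B : Subset n} {w} → Lists (z ∷ zs) A B → w ∈ z ∷ zs → w ≢ z → w ∈ zs
      drop _ (here eq) ne = ⊥-elim (ne eq)
      drop _ (there w∈) _ = w∈
      fresh : ∀ {z zs} {A B : Subset n} → Lists (z ∷ zs) A B → Unique zs × z ∉ zs
      fresh X with Lists.unique X
      ... | u@(_ ∷ un) = un , head∉tail u
      X₁ : Lists xs S S₁
      X₁ = record
        { unique = proj₁ (fresh X)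
        ; sound = λ w∈ → let (a , b) = Lists.sound X (there w∈) in
                  a , trans (other (λ { refl → proj₂ (fresh X) w∈ }) (differ S a yS)) b
        ; complete = λ {w} a b → drop X (Lists.complete X a (trans (sym (other
                       (differ S₁ (move-target S′ y x) b ∘ sym) (differ S a yS))) b))
                       (differ S₁ (move-target S′ y x) b ∘ sym) }
      Y₁ : Lists ys S₁ S
      Y₁ = record
        { unique = proj₁ (fresh Y)
        ; sound = λ w∈ → let (a , b) = Lists.sound Y (there w∈) in
                  trans (other (differ S xS b ∘ sym) (λ { refl → proj₂ (fresh Y) w∈ })) a , b
        ; complete = λ {w} a b → drop Y (Lists.complete Y (trans (sym (other
                       (differ S xS b ∘ sym) (differ S₁ a (moved-out S′ y x yS′ xS′)))) a) b)
                       (differ S₁ a (moved-out S′ y x yS′ xS′)) }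
      -- `x` is missing from `S′` and `y` from `S`, so neither is in `C`.
      CS₁ : ∀ w → C w → lookup S₁ w ≡ true
      CS₁ w cw = trans (other (differ S′ (CS′ w cw) xS′) (differ S (CS w cw) yS)) (CS′ w cw)
      IH = exchange xs ys S₁ run CS CS₁ X₁ Y₁ (trans card (sym (move-card S′ y x yS′ xS′)))

-- The canonical covers reached from `I` and `J`.

module Canonical {n : ℕ} {G : Graph n} (L : AdjacencyLists G) (k : ℕ) (2≤k : 2 ≤ k)
                 (connected : Connected G) (acyclic : Acyclic G) (root : Fin n) where
  open Traversal L
  open Runs k G
  open Sweep L k 2≤k
  open Collect L k 2≤k

  tree : Trav n root (nbrs L root)
  tree = traverse acyclic root

  all-verts : ∀ w → w ∈ root ∷ verts tree
  all-verts w = go (here refl) (connected root w)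
    where
    go : ∀ {v} → v ∈ root ∷ verts tree → Star (Adj G) v w → w ∈ root ∷ verts tree
    go v∈ ε = v∈
    go v∈ (e ◅ p) with closed tree v∈ e
    ... | inj₁ z∈ = go z∈ p
    ... | inj₂ eq = ⊥-elim (<⇒≢ (Fin.toℕ<n _) eq)

  gathered : Subset n → Progress n
  gathered I = visitS tree (progress I nothing [])

  module _ {I : Subset n} (cov : Cover I) where

    gathered-run : Run I (Progress.jumps (gathered I)) (Progress.cover (gathered I))
    gathered-run = proj₁ (visit-good tree (progress I nothing []) (tree-unique acyclic tree) (start cov))

    gathered-cuts : ∀ w → CutAt tree w → lookup (Progress.cover (gathered I)) w ≡ true
    gathered-cuts w cw = proj₁ (Settled.cuts (proj₂ (proj₂
      (visit-good tree (progress I nothing []) (tree-unique acyclic tree) (start cov)))) w cw)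

  cut-covering : ∀ S → (∀ w → CutAt tree w → lookup S w ≡ true) → Cover S
  cut-covering S cuts = cuts-cover S tree (tree-unique acyclic tree) (λ w → cuts w ∘ inj₁)
    (λ eq → cuts root (inj₂ (refl , eq))) all-verts

  tree-size : suc (size tree) ≤ n
  tree-size = unique-length (tree-unique acyclic tree)

  gathered-jumps : ∀ I → length (Progress.jumps (gathered I)) ≤ n
  gathered-jumps I = ≤-trans (leave-jumps root (tall tree) (scanS tree (descendInto root (progress I nothing []))))
    (≤-trans (s≤s (≤-trans (scanS-jumps tree _) (≤-reflexive (+-identityʳ _)))) tree-size)

-- Timed execution of programs, and the program of the search.

≡ᵇ-refl : ∀ {i j} → i ≡ j → (i ≡ᵇ j) ≡ true
≡ᵇ-refl {i} {j} eq with i ≡ᵇ j in e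
... | true  = refl
... | false = ⊥-elim (subst T e (≡⇒≡ᵇ i j eq))

≡ᵇ-≢ : ∀ {i j} → i ≢ j → (i ≡ᵇ j) ≡ false
≡ᵇ-≢ {i} {j} ne with i ≡ᵇ j in e
... | false = refl
... | true  = ⊥-elim (ne (≡ᵇ⇒≡ i j (subst T (sym e) tt)))

put : (ℕ → ℕ) → ℕ → ℕ → ℕ → ℕ
put f i v j = if j ≡ᵇ i then v else f j

put-same : ∀ f {i j} v → j ≡ i → put f i v j ≡ v
put-same f v eq rewrite ≡ᵇ-refl eq = refl

put-other : ∀ f {i j} v → j ≢ i → put f i v j ≡ f j
put-other f v ne rewrite ≡ᵇ-≢ ne = refl

-- A branch of a loop-free program.  Naming final states by branches keeps them
-- small: written out, they grow exponentially with the length of the program.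
data Branch : Program → Set where
  skip    : Branch skip
  const   : ∀ {r v} → Branch (const r v)
  copy    : ∀ {r q} → Branch (copy r q)
  inc     : ∀ {r} → Branch (inc r)
  dec     : ∀ {r} → Branch (dec r)
  load    : ∀ {r a i} → Branch (load r a i)
  store   : ∀ {a i r} → Branch (store a i r)
  _⨾_     : ∀ {P Q} → Branch P → Branch Q → Branch (P ⨾ Q)
  ifTrue  : ∀ {b P Q} → Branch P → Branch (ifThen b P Q)
  ifFalse : ∀ {b P Q} → Branch Q → Branch (ifThen b P Q)

exec : ∀ {P} → Branch P → State → State
exec skip                  s = s
exec (const {r} {v})       s = setReg r v s
exec (copy {r} {q})        s = setReg r (reg s q) s
exec (inc {r})             s = setReg r (suc (reg s r)) s
exec (dec {r})             s = setReg r (pred (reg s r)) s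
exec (load {r} {a} {i})    s = setReg r (arr s a (reg s i)) s
exec (store {a} {i} {r})   s = setArr a (reg s i) (reg s r) s
exec (β ⨾ γ)               s = exec γ (exec β s)
exec (ifTrue β)            s = exec β s
exec (ifFalse β)           s = exec β s

steps : ∀ {P} → Branch P → ℕ
steps (β ⨾ γ)     = steps β + steps γ
steps (ifTrue β)  = suc (steps β)
steps (ifFalse β) = suc (steps β)
steps _           = 1

-- The continuation `K` evaluates each test in the state where it is met. Commands without a test
-- leave no trace, so a proof is just the tuple of tests along the branch, ended by a proof of `K`.
Taken : ∀ {P} → Branch P → State → Set → Set
Taken (β ⨾ γ)             s K = Taken β s (Taken γ (exec β s) K)
Taken (ifTrue {b = b} β)  s K = test b s ≡ true × Taken β s K
Taken (ifFalse {b = b} β) s K = test b s ≡ false × Taken β s K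
Taken _                   s K = K

exec-sound : ∀ {P} (β : Branch P) s {K} → Taken β s K → ⟪ P , s ⟫⇓ exec β s ∣ steps β × K
exec-sound skip  s k = skip , k
exec-sound const s k = const , k
exec-sound copy  s k = copy , k
exec-sound inc   s k = inc , k
exec-sound dec   s k = dec , k
exec-sound load  s k = load , k
exec-sound store s k = store , k
exec-sound (β ⨾ γ) s k with exec-sound β s k
... | d , k′ with exec-sound γ (exec β s) k′
...   | e , k″ = (d ⨾ e) , k″
exec-sound (ifTrue β) s (t , k) with exec-sound β s k
... | d , k′ = ifTrue t d , k′
exec-sound (ifFalse β) s (t , k) with exec-sound β s k
... | d , k′ = ifFalse t d , k′

-- The number of steps is a closed numeral for a concrete branch, so the time bound is checked by
-- evaluation and its implicit proof is found automatically.
take-branch : ∀ {P s b Q} (β : Branch P) → {T (steps β ≤ᵇ b)} → Taken β s ⊤ → Q (exec β s) → HaltsWithin P s b Q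
take-branch {s = s} β {fast} k q = exec β s , steps β , proj₁ (exec-sound β s k) , ≤ᵇ⇒≤ _ _ fast , q

then-halts : ∀ {P P′ s b c Q R} → HaltsWithin P s b Q → (∀ s′ → Q s′ → HaltsWithin P′ s′ c R) →
             HaltsWithin (P ⨾ P′) s (b + c) R
then-halts (s′ , t , d , t≤ , q) f with f s′ q
... | s″ , u , d′ , u≤ , r = s″ , t + u , (d ⨾ d′) , +-mono-≤ t≤ u≤ , r

if-true : ∀ {β P P′ s b Q} → test β s ≡ true → HaltsWithin P s b Q → HaltsWithin (ifThen β P P′) s (suc b) Q
if-true tr (s′ , t , d , t≤ , q) = s′ , suc t , ifTrue tr d , s≤s t≤ , q

if-false : ∀ {β P P′ s b Q} → test β s ≡ false → HaltsWithin P′ s b Q → HaltsWithin (ifThen β P P′) s (suc b) Q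
if-false fa (s′ , t , d , t≤ , q) = s′ , suc t , ifFalse fa d , s≤s t≤ , q

within : ∀ {P s b c Q} → b ≤ c → HaltsWithin P s b Q → HaltsWithin P s c Q
within b≤c (s′ , t , d , t≤ , q) = s′ , t , d , ≤-trans t≤ b≤c , q

module Loop (b : Test) (P : Program) where

  data Iterates : State → ℕ → State → Set where
    []   : ∀ {s} → Iterates s 0 s
    _∷_  : ∀ {s s′ s″ t u} → test b s ≡ true × ⟪ P , s ⟫⇓ s′ ∣ t → Iterates s′ u s″ →
           Iterates s (suc (t + u)) s″

  -- The big-step rules describe only loops run to the end. Stretches of iterations can be
  -- concatenated, which is what a recursion over the tree needs.
  Reach : State → ℕ → (State → Set) → Set
  Reach s m Q = ∃[ s′ ] ∃[ t ] Iterates s t s′ × t ≤ m × Q s′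

  iterates-++ : ∀ {s t s′ u s″} → Iterates s t s′ → Iterates s′ u s″ → Iterates s (t + u) s″
  iterates-++ []               is = is
  iterates-++ {u = u} {s″} (_∷_ {s = s} {t = t₁} {u₁} d ds) is =
    subst (λ m → Iterates s m s″) (cong suc (sym (+-assoc t₁ u₁ u))) (d ∷ iterates-++ ds is)

  stay : ∀ {s Q} → Q s → Reach s 0 Q
  stay q = _ , 0 , [] , z≤n , q

  once : ∀ {s m Q} → test b s ≡ true → HaltsWithin P s m Q → Reach s (suc m) Q
  once {m = m} tr (s′ , t , d , t≤ , q) =
    s′ , _ , (tr , d) ∷ [] , s≤s (subst (_≤ m) (sym (+-identityʳ t)) t≤) , q

  infixr 1 _then_

  _then_ : ∀ {s m m′ Q R} → Reach s m Q → (∀ s′ → Q s′ → Reach s′ m′ R) → Reach s (m + m′) R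
  (s′ , t , is , t≤ , q) then f with f s′ q
  ... | s″ , u , is′ , u≤ , r = s″ , _ , iterates-++ is is′ , +-mono-≤ t≤ u≤ , r

  reach-≤ : ∀ {s m m′ Q} → m ≤ m′ → Reach s m Q → Reach s m′ Q
  reach-≤ le (s′ , t , is , t≤ , q) = s′ , t , is , ≤-trans t≤ le , q

  exit : ∀ {s m Q R} → Reach s m Q → (∀ s′ → Q s′ → test b s′ ≡ false × R s′) →
         HaltsWithin (while b P) s (suc m) R
  exit {m = m} (s′ , t , is , t≤ , q) f =
    s′ , t + 1 , run is (proj₁ (f s′ q)) , subst (_≤ suc m) (+-comm 1 t) (s≤s t≤) , proj₂ (f s′ q)
    where
    run : ∀ {s t s′} → Iterates s t s′ → test b s′ ≡ false → ⟪ while b P , s ⟫⇓ s′ ∣ t + 1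
    run []              fa = done fa
    run {s} {s′ = s′} (_∷_ {t = t} {u} (tr , d) is) fa =
      subst (λ m → ⟪ while b P , s ⟫⇓ s′ ∣ suc m) (sym (+-assoc t u 1)) (loop tr d (run is fa))

-- Registers: 2 holds k, 3 the depth d of the search, 4 the vertex on top, 5 and
-- 6 the current and the final position in its adjacency list, 8, 9 and 10 are
-- scratch, 11 holds 0.  Arrays 8 to 12 hold, for every depth, the vertex, the
-- position in its adjacency list, the height H, k ∸ H and the token, where n
-- stands for no token.  Depth 0 is a sentinel with the non-vertex n.
push settleStep combineHeight combineToken readNext visitNext finish fetch body : Program

push =
  inc 3 ⨾ store 8 3 8 ⨾ load 9 0 8 ⨾ store 9 3 9 ⨾ const 9 1 ⨾ store 10 3 9 ⨾
  copy 9 2 ⨾ dec 9 ⨾ store 11 3 9 ⨾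
  load 9 2 8 ⨾ ifThen (11 ≺ 9) (store 12 3 8) (store 12 3 0)

readNext = load 8 1 5 ⨾ inc 5 ⨾ store 9 3 5 ⨾ copy 9 3 ⨾ dec 9 ⨾ load 9 8 9

-- The vertex one frame below is the one from which the current vertex was entered. Skipping it
-- takes the place of visited marks.
visitNext = readNext ⨾ ifThen (8 ≐ 9) skip push

settleStep =
  load 8 10 3 ⨾ load 9 11 3 ⨾ load 10 12 3 ⨾
  ifThen (8 ≐ 2)
    -- A cut vertex returns height 0, the complement `k ∸ 0`, and at the end `n` for no token.
    (const 8 0 ⨾ copy 9 2 ⨾ load 5 2 4 ⨾
     ifThen (5 ≐ 11)
       (ifThen (10 ≐ 0) skip
         (store 4 1 10 ⨾ store 5 1 4 ⨾ inc 1 ⨾ const 5 1 ⨾ store 2 10 11 ⨾ store 2 4 5))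
       skip ⨾
     copy 10 0)
    skip

combineHeight =
  dec 3 ⨾ load 5 10 3 ⨾
  ifThen (5 ≺ 9)
    (ifThen (8 ≺ 5) skip (inc 8 ⨾ dec 9 ⨾ store 10 3 8 ⨾ store 11 3 9))
    (store 10 3 2 ⨾ store 11 3 11)

combineToken = ifThen (10 ≐ 0) skip (store 12 3 10)

finish = settleStep ⨾ combineHeight ⨾ combineToken

fetch = load 4 8 3 ⨾ load 5 9 3 ⨾ copy 6 4 ⨾ inc 6 ⨾ load 6 0 6

body = fetch ⨾ ifThen (5 ≐ 6) finish visitNext

dfs : ℕ → Program
dfs k = start-up ⨾ push ⨾ while (11 ≺ 3) body
  where
  -- The sentinel has height `k` with complement 0, and position 0, which ends its empty list
  -- because array 0 holds 0 at `n + 1`. The last command chooses vertex 0 as the root.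
  start-up = const 2 k ⨾ const 11 0 ⨾ const 3 0 ⨾
             store 8 3 0 ⨾ store 9 3 11 ⨾ store 10 3 2 ⨾ store 11 3 11 ⨾ store 12 3 0 ⨾ const 8 0

-- Sets, logs and adjacency lists represented in arrays.

bit : Bool → ℕ
bit b = if b then 1 else 0

SetRep : ∀ {n} → (ℕ → ℕ) → Subset n → Set
SetRep f S = ∀ w → f (toℕ w) ≡ bit (lookup S w)

setRep-put : ∀ {n f V b} {S : Subset n} {v} → SetRep f S → V ≡ toℕ v →
             SetRep (put f V (bit b)) (S [ v ]≔ b)
setRep-put {f = f} {b = b} {S} {v} rep refl w with w Fin.≟ v
... | yes refl = trans (put-same f {toℕ v} (bit b) refl) (cong bit (sym (lookup∘update v S b)))
... | no w≢v   = trans (put-other f (bit b) (w≢v ∘ Fin.toℕ-injective))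
                   (trans (rep w) (cong bit (sym (lookup∘update′ w≢v S b))))

holds-cong : ∀ {f g} xs → (∀ j → j < length xs → g j ≡ f j) → Holds f xs → Holds g xs
holds-cong []       eq _        = tt
holds-cong (x ∷ xs) eq (fx , h) = trans (eq _ ≤-refl) fx , holds-cong xs (λ j → eq j ∘ m≤n⇒m≤1+n) h

holds-put : ∀ {f i a x} xs → Holds f xs → i ≡ length xs → a ≡ x → Holds (put f i a) (x ∷ xs)
holds-put {f} {a = a} xs h refl refl = put-same f a refl ,
  holds-cong xs (λ j lt → put-other f a (<⇒≢ lt)) h

Logged : ∀ {n} → (ℕ → ℕ) → (ℕ → ℕ) → List (Fin n × Fin n) → Set
Logged f g l = Holds f (map (toℕ ∘ proj₁) l) × Holds g (map (toℕ ∘ proj₂) l)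

logged-put : ∀ {n f g i a b} {x y : Fin n} l → Logged f g l → i ≡ length l → a ≡ toℕ x → b ≡ toℕ y →
             Logged (put f i a) (put g i b) ((x , y) ∷ l)
logged-put l (X , Y) i≡ a≡ b≡ =
  holds-put (map (toℕ ∘ proj₁) l) X (trans i≡ (sym (length-map (toℕ ∘ proj₁) l))) a≡ ,
  holds-put (map (toℕ ∘ proj₂) l) Y (trans i≡ (sym (length-map (toℕ ∘ proj₂) l))) b≡

-- Stated with the Boolean results of the machine's end-of-list test, so that the representation
-- directly supplies the outcome of the branch.
Seg : ∀ {n} → (ℕ → ℕ) → ℕ → ℕ → List (Fin n) → Set
Seg f i e []       = (i ≡ᵇ e) ≡ true
Seg f i e (u ∷ us) = (i ≡ᵇ e) ≡ false × f i ≡ toℕ u × Seg f (suc i) e us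

record Frame (n : ℕ) : Set where
  constructor frame
  field
    vertex : ℕ
    todo   : List (Fin n)
    height : ℕ
    tok    : Maybe (Fin n)

-- Correctness and running time of the search.

module Simulation {n : ℕ} {G : Graph n} (L : AdjacencyLists G) (k : ℕ) (2≤k : 2 ≤ k)
  (off cells : ℕ → ℕ) (seg : ∀ v → Seg cells (off (toℕ v)) (off (suc (toℕ v))) (nbrs L v))
  (m₇ : ℕ) (a₃ a₆ a₇ : ℕ → ℕ) where

  open Traversal L
  open Sweep L k 2≤k
  open Collect L k 2≤k
  open Loop (11 ≺ 3) body

  enc : Maybe (Fin n) → ℕ
  enc nothing  = n
  enc (just x) = toℕ x

  -- Register 7 and arrays 3, 6 and 7 belong to the search for the other cover; keeping them fixed
  -- lets the two searches run one after the other.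
  Static : State → Set
  Static s = reg s 0 ≡ n × reg s 2 ≡ k × reg s 11 ≡ 0 × reg s 7 ≡ m₇ ×
             (∀ j → arr s 0 j ≡ off j) × (∀ j → arr s 1 j ≡ cells j) ×
             (∀ j → arr s 3 j ≡ a₃ j) × (∀ j → arr s 6 j ≡ a₆ j) × (∀ j → arr s 7 j ≡ a₇ j)

  FrameAt : State → ℕ → Frame n → Set
  FrameAt s d (frame v us H τ) =
    arr s 8 d ≡ v × Seg cells (arr s 9 d) (off (suc v)) us × arr s 10 d ≡ H × arr s 11 d ≡ k ∸ H × arr s 12 d ≡ enc τ

  Stack : State → List (Frame n) → Set
  Stack s []       = ⊤
  Stack s (f ∷ fs) = FrameAt s (length fs) f × Stack s fs

  Agree : State → State → ℕ → Set
  Agree s s′ j = arr s′ 8 j ≡ arr s 8 j × arr s′ 9 j ≡ arr s 9 j × arr s′ 10 j ≡ arr s 10 j ×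
                 arr s′ 11 j ≡ arr s 11 j × arr s′ 12 j ≡ arr s 12 j

  frame-cong : ∀ {s s′ d} f → Agree s s′ d → FrameAt s d f → FrameAt s′ d f
  frame-cong (frame v us H τ) (e₈ , e₉ , e₁₀ , e₁₁ , e₁₂) (v≡ , sg , H≡ , G≡ , τ≡) =
    trans e₈ v≡ , subst (λ i → Seg cells i (off (suc v)) us) (sym e₉) sg , trans e₁₀ H≡ , trans e₁₁ G≡ , trans e₁₂ τ≡

  stack-cong : ∀ {s s′} fs → (∀ j → j < length fs → Agree s s′ j) → Stack s fs → Stack s′ fs
  stack-cong []       _  _          = tt
  stack-cong {s} {s′} (f ∷ fs) ag (fr , st) =
    frame-cong {s} {s′} f (ag _ ≤-refl) fr , stack-cong fs (λ j → ag j ∘ m≤n⇒m≤1+n) st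

  Log : State → List (Fin n × Fin n) → Set
  Log s l = reg s 1 ≡ length l × Logged (arr s 4) (arr s 5) l

  -- The top frame is kept apart from `fs` because its token is the one in hand in `o`; the tokens
  -- of the frames below are waiting.
  record Rep (s : State) (v : ℕ) (us : List (Fin n)) (H : ℕ) (fs : List (Frame n)) (o : Progress n) : Set where
    constructor rep
    field
      static : Static s
      depth  : reg s 3 ≡ length fs
      top    : FrameAt s (reg s 3) (frame v us H (Progress.token o))
      below  : Stack s fs
      set    : SetRep (arr s 2) (Progress.cover o)
      log    : Log s (Progress.jumps o)

  enc-test : ∀ {t} → t ≡ n → ∀ x → (toℕ {n} x ≡ᵇ t) ≡ false
  enc-test refl x = ≡ᵇ-≢ (<⇒≢ (Fin.toℕ<n x))

  push-halts : ∀ {s v us H fs o} u → Rep s v us H fs o → reg s 8 ≡ toℕ u →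
    HaltsWithin push s 20
      (λ s′ → Rep s′ (toℕ u) (nbrs L u) 1 (frame v us H (Progress.token o) ∷ fs) (descendInto u o))
  push-halts {s} {v} {us} {H} {fs} {progress S τ l} u
    (rep static@(r₀ , r₂ , r₁₁ , _ , a₀ , _) depth top below set log) r₈
    = branch (lookup S u) refl
    where
    d : ℕ
    d = suc (reg s 3)
    a₂ : arr s 2 (reg s 8) ≡ bit (lookup S u)
    a₂ = trans (cong (arr s 2) r₈) (set u)
    entry : put (arr s 9) d (arr s 0 (reg s 8)) d ≡ off (toℕ u)
    entry = trans (put-same (arr s 9) {d} (arr s 0 (reg s 8)) refl) (trans (cong (arr s 0) r₈) (a₀ (toℕ u)))
    seg′ : ∀ {i} → i ≡ off (toℕ u) → Seg cells i (off (suc (toℕ u))) (nbrs L u)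
    seg′ refl = seg u
    lower : ∀ {j} → j < suc (length fs) → j ≢ d
    lower lt eq = <⇒≢ (subst (λ d → _ < suc d) (sym depth) lt) eq
    whole : Stack s (frame v us H τ ∷ fs)
    whole = subst (λ d → FrameAt s d (frame v us H τ)) depth top , below
    k∸1 : pred (reg s 2) ≡ k ∸ 1
    k∸1 = trans (pred[m∸n]≡m∸[1+n] (reg s 2) 0) (cong (_∸ 1) r₂)
    agree : ∀ t j → j < suc (length fs) →
            put (arr s 8) d (reg s 8) j ≡ arr s 8 j × put (arr s 9) d (arr s 0 (reg s 8)) j ≡ arr s 9 j ×
            put (arr s 10) d 1 j ≡ arr s 10 j × put (arr s 11) d (pred (reg s 2)) j ≡ arr s 11 j ×
            put (arr s 12) d t j ≡ arr s 12 j
    agree t j lt = put-other (arr s 8) (reg s 8) (lower lt) , put-other (arr s 9) (arr s 0 (reg s 8)) (lower lt)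
                 , put-other (arr s 10) 1 (lower lt) , put-other (arr s 11) (pred (reg s 2)) (lower lt)
                 , put-other (arr s 12) t (lower lt)
    branch : ∀ b → lookup S u ≡ b →
      HaltsWithin push s 20 (λ s′ → Rep s′ (toℕ u) (nbrs L u) 1 (frame v us H τ ∷ fs) (descendInto u (progress S τ l)))
    branch true Su = take-branch β (cong₂ _<ᵇ_ r₁₁ (trans a₂ (cong bit Su)) , tt)
      (rep static (cong suc depth)
          ( trans (put-same (arr s 8) {d} (reg s 8) refl) r₈ , seg′ entry , put-same (arr s 10) {d} 1 refl
          , trans (put-same (arr s 11) {d} (pred (reg s 2)) refl) k∸1
          , trans (put-same (arr s 12) {d} (reg s 8) refl) (trans r₈ (sym (cong enc τ≡))))
          (stack-cong {s} {exec β s} (frame v us H τ ∷ fs) (agree (reg s 8)) whole)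
          set log)
      where
      β : Branch push
      β = inc ⨾ store ⨾ load ⨾ store ⨾ const ⨾ store ⨾ copy ⨾ dec ⨾ store ⨾ load ⨾ ifTrue store
      τ≡ : enter u S ≡ just u
      τ≡ rewrite Su = refl
    branch false Su = take-branch β (cong₂ _<ᵇ_ r₁₁ (trans a₂ (cong bit Su)) , tt)
      (rep static (cong suc depth)
          ( trans (put-same (arr s 8) {d} (reg s 8) refl) r₈ , seg′ entry , put-same (arr s 10) {d} 1 refl
          , trans (put-same (arr s 11) {d} (pred (reg s 2)) refl) k∸1
          , trans (put-same (arr s 12) {d} (reg s 0) refl) (trans r₀ (sym (cong enc τ≡))))
          (stack-cong {s} {exec β s} (frame v us H τ ∷ fs) (agree (reg s 0)) whole)
          set log)
      where
      β : Branch push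
      β = inc ⨾ store ⨾ load ⨾ store ⨾ const ⨾ store ⨾ copy ⨾ dec ⨾ store ⨾ load ⨾ ifFalse store
      τ≡ : enter u S ≡ nothing
      τ≡ rewrite Su = refl

  visit-halts : ∀ {s v u us H g fs o} → Rep s v (u ∷ us) H (g ∷ fs) o → reg s 5 ≡ arr s 9 (reg s 3) →
    HaltsWithin readNext s 6
      (λ s′ → Rep s′ v us H (g ∷ fs) o × reg s′ 8 ≡ toℕ u × reg s′ 9 ≡ Frame.vertex g)
  visit-halts {s} {v} {u} {us} {H} {frame p ps K σ} {fs} {o}
    (rep static@(_ , _ , _ , _ , _ , a₁ , _) depth (v≡ , (_ , u≡ , sg) , H≡ , G≡ , τ≡) below@((p≡ , _) , _) set log) r₅
    = take-branch β tt
        ( rep static depth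
            (v≡ , seg′ (trans (put-same (arr s 9) {reg s 3} (suc (reg s 5)) refl) (cong suc r₅)) , H≡ , G≡ , τ≡)
            (stack-cong {s} {exec β s} (frame p ps K σ ∷ fs)
              (λ j lt → refl , put-other (arr s 9) (suc (reg s 5)) (lower lt) , refl , refl , refl) below)
            set log
        , trans (a₁ (reg s 5)) (trans (cong cells r₅) u≡)
        , trans (cong (λ d → arr s 8 (pred d)) depth) p≡ )
    where
    β : Branch readNext
    β = load ⨾ inc ⨾ store ⨾ copy ⨾ dec ⨾ load
    seg′ : ∀ {i} → i ≡ suc (arr s 9 (reg s 3)) → Seg cells i (off (suc v)) us
    seg′ refl = sg
    lower : ∀ {j} → j < suc (length fs) → j ≢ reg s 3
    lower lt eq = <⇒≢ lt (trans eq depth)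

  record Popped (s : State) (h : ℕ) (fs : List (Frame n)) (o : Progress n) : Set where
    constructor popped
    field
      static   : Static s
      depth    : reg s 3 ≡ length fs
      below    : Stack s fs
      returned : reg s 8 ≡ h × reg s 9 ≡ k ∸ h × reg s 10 ≡ enc (Progress.token o)
      set      : SetRep (arr s 2) (Progress.cover o)
      log      : Log s (Progress.jumps o)

  settle-halts : ∀ {s H fs o} v → Rep s (toℕ v) [] H fs o → reg s 4 ≡ toℕ v →
    HaltsWithin settleStep s 20 (λ s′ → Popped s′ (ret H) fs (leave v H o))
  settle-halts {s} {H} {fs} {o} v
    (rep static@(r₀ , r₂ , r₁₁ , _) depth (_ , _ , H≡ , G≡ , τ≡) below set log) r₄
    with H ≡ᵇ k in eq
  ... | false = take-branch β (trans (cong₂ _≡ᵇ_ H≡ r₂) eq , tt)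
      (popped static depth (stack-cong {s} {exec β s} fs (λ _ _ → refl , refl , refl , refl , refl) below)
        (H≡ , G≡ , τ≡) set log)
      where
      β : Branch settleStep
      β = load ⨾ load ⨾ load ⨾ ifFalse skip
  ... | true = settled (lookup (Progress.cover o) v) refl o refl set log τ≡
    where
    tallest : (arr s 10 (reg s 3) ≡ᵇ reg s 2) ≡ true
    tallest = trans (cong₂ _≡ᵇ_ H≡ r₂) eq
    settled : ∀ b → lookup (Progress.cover o) v ≡ b → ∀ o₁ → o₁ ≡ o → SetRep (arr s 2) (Progress.cover o₁) →
      Log s (Progress.jumps o₁) → arr s 12 (reg s 3) ≡ enc (Progress.token o₁) →
      HaltsWithin settleStep s 20 (λ s′ → Popped s′ 0 fs (settle v b o₁))
    settled true Sv (progress S τ l) refl set log τ≡ =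
      take-branch β (tallest , cong₂ _≡ᵇ_ (trans (cong (arr s 2) r₄) (trans (set v) (cong bit Sv))) r₁₁ , tt)
        (popped static depth (stack-cong {s} {exec β s} fs (λ _ _ → refl , refl , refl , refl , refl) below)
          (refl , r₂ , r₀) set log)
      where
      β : Branch settleStep
      β = load ⨾ load ⨾ load ⨾ ifTrue (const ⨾ copy ⨾ load ⨾ ifFalse skip ⨾ copy)
    settled false Sv (progress S nothing l) refl set log τ≡ =
      take-branch β (tallest , cong₂ _≡ᵇ_ (trans (cong (arr s 2) r₄) (trans (set v) (cong bit Sv))) r₁₁
                    , ≡ᵇ-refl (trans τ≡ (sym r₀)) , tt)
        (popped static depth (stack-cong {s} {exec β s} fs (λ _ _ → refl , refl , refl , refl , refl) below)
          (refl , r₂ , r₀) set log)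
      where
      β : Branch settleStep
      β = load ⨾ load ⨾ load ⨾ ifTrue (const ⨾ copy ⨾ load ⨾ ifTrue (ifTrue skip) ⨾ copy)
    settled false Sv (progress S (just x) l) refl set (r₁ , XY) τ≡ =
      take-branch β (tallest , cong₂ _≡ᵇ_ (trans (cong (arr s 2) r₄) (trans (set v) (cong bit Sv))) r₁₁
                    , trans (cong (_≡ᵇ reg s 0) τ≡) (enc-test r₀ x) , tt)
        (popped static depth (stack-cong {s} {exec β s} fs (λ _ _ → refl , refl , refl , refl , refl) below)
          (refl , r₂ , r₀)
          (subst (λ z → SetRep (put (put (arr s 2) (arr s 12 (reg s 3)) z) (reg s 4) 1) (move S x v)) (sym r₁₁)
            (setRep-put {f = put (arr s 2) (arr s 12 (reg s 3)) 0} {b = true} {S [ x ]≔ false}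
              (setRep-put {f = arr s 2} {b = false} {S} set τ≡) r₄))
          (cong suc r₁ , logged-put l XY r₁ τ≡ r₄))
      where
      β : Branch settleStep
      β = load ⨾ load ⨾ load ⨾
          ifTrue (const ⨾ copy ⨾ load ⨾ ifTrue (ifFalse (store ⨾ store ⨾ inc ⨾ const ⨾ store ⨾ store)) ⨾ copy)

  combine-halts : ∀ {s h p us H τ fs o} → Popped s h (frame p us H τ ∷ fs) o →
    HaltsWithin combineHeight s 10
      (λ s′ → Rep s′ p us (comb H h) fs (record o { token = τ }) × reg s′ 10 ≡ enc (Progress.token o))
  combine-halts {s} {h} {p} {us} {H} {τ} {fs} {o}
    (popped static@(_ , r₂ , r₁₁ , _) depth (fr , below) (r₈ , r₉ , r₁₀) set log) = go (comb-tests H h)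
    where
    d : ℕ
    d = pred (reg s 3)
    d≡ : d ≡ length fs
    d≡ = cong pred depth
    top : FrameAt s d (frame p us H τ)
    top = subst (λ d → FrameAt s d (frame p us H τ)) (sym d≡) fr
    lower : ∀ {j} → j < length fs → j ≢ d
    lower lt eq = <⇒≢ lt (trans eq d≡)
    H≡ = proj₁ (proj₂ (proj₂ top))
    test₁ : ∀ {b} → (H <ᵇ (k ∸ h)) ≡ b → (arr s 10 d <ᵇ reg s 9) ≡ b
    test₁ = trans (cong₂ _<ᵇ_ H≡ r₉)
    test₂ : ∀ {b} → (h <ᵇ H) ≡ b → (reg s 8 <ᵇ arr s 10 d) ≡ b
    test₂ = trans (cong₂ _<ᵇ_ r₈ H≡)
    go : ∀ {m} → CombTests H h m → HaltsWithin combineHeight s 10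
      (λ s′ → Rep s′ p us m fs (record o { token = τ }) × reg s′ 10 ≡ enc (Progress.token o))
    go (flag t₁) = take-branch β (test₁ t₁ , tt)
      ( rep static d≡
          ( proj₁ top , proj₁ (proj₂ top) , trans (put-same (arr s 10) {d} (reg s 2) refl) r₂
          , trans (put-same (arr s 11) {d} (reg s 11) refl) (trans r₁₁ (sym (n∸n≡0 k)))
          , proj₂ (proj₂ (proj₂ (proj₂ top))))
          (stack-cong {s} {exec β s} fs
            (λ j lt → refl , refl , put-other (arr s 10) (reg s 2) (lower lt) , put-other (arr s 11) (reg s 11) (lower lt) , refl)
            below)
          set log
      , r₁₀)
      where
      β : Branch combineHeight
      β = dec ⨾ load ⨾ ifFalse (store ⨾ store)
    go (keep t₁ t₂) = take-branch β (test₁ t₁ , test₂ t₂ , tt)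
      ( rep static d≡ top (stack-cong {s} {exec β s} fs (λ j lt → refl , refl , refl , refl , refl) below) set log
      , r₁₀)
      where
      β : Branch combineHeight
      β = dec ⨾ load ⨾ ifTrue (ifTrue skip)
    go (grow t₁ t₂) = take-branch β (test₁ t₁ , test₂ t₂ , tt)
      ( rep static d≡
          ( proj₁ top , proj₁ (proj₂ top) , trans (put-same (arr s 10) {d} (suc (reg s 8)) refl) (cong suc r₈)
          , trans (put-same (arr s 11) {d} (pred (reg s 9)) refl) (trans (cong pred r₉) (pred[m∸n]≡m∸[1+n] k h))
          , proj₂ (proj₂ (proj₂ (proj₂ top))))
          (stack-cong {s} {exec β s} fs
            (λ j lt → refl , refl , put-other (arr s 10) (suc (reg s 8)) (lower lt)
                    , put-other (arr s 11) (pred (reg s 9)) (lower lt) , refl)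
            below)
          set log
      , r₁₀)
      where
      β : Branch combineHeight
      β = dec ⨾ load ⨾ ifTrue (ifFalse (inc ⨾ dec ⨾ store ⨾ store))

  token-halts : ∀ {s p us H τ fs o} → Rep s p us H fs (record o { token = τ }) → reg s 10 ≡ enc (Progress.token o) →
    HaltsWithin combineToken s 2 (λ s′ → Rep s′ p us H fs (returnTo τ o))
  token-halts {s} {p} {us} {H} {τ} {fs} {progress S nothing l}
    r@(rep static@(r₀ , _) _ _ _ _ _) r₁₀ =
    take-branch (ifTrue skip) (≡ᵇ-refl (trans r₁₀ (sym r₀)) , tt) r
  token-halts {s} {p} {us} {H} {τ} {fs} {progress S (just x) l}
    (rep static@(r₀ , _) depth (v≡ , sg , H≡ , G≡ , τ≡) below set log) r₁₀ =
    take-branch β (trans (cong (_≡ᵇ reg s 0) r₁₀) (enc-test r₀ x) , tt)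
      (rep static depth (v≡ , sg , H≡ , G≡ , trans (put-same (arr s 12) {reg s 3} (reg s 10) refl) r₁₀)
        (stack-cong {s} {exec β s} fs
          (λ j lt → refl , refl , refl , refl , put-other (arr s 12) (reg s 10) (λ eq → <⇒≢ lt (trans eq depth)))
          below)
        set log)
    where
    β : Branch combineToken
    β = ifFalse store

  fetch-halts : ∀ {s v us H fs o} → Rep s v us H fs o → HaltsWithin fetch s 5
    (λ s′ → Rep s′ v us H fs o × reg s′ 4 ≡ v × reg s′ 5 ≡ arr s′ 9 (reg s′ 3) × reg s′ 6 ≡ off (suc v))
  fetch-halts {s} {v} {us} {H} {fs} {o} (rep static@(_ , _ , _ , _ , a₀ , _) depth top below set log) =
    take-branch β tt
      ( rep static depth top (stack-cong {s} {exec β s} fs (λ _ _ → refl , refl , refl , refl , refl) below) set log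
      , proj₁ top , refl , trans (cong (λ v → arr s 0 (suc v)) (proj₁ top)) (a₀ (suc v)))
    where
    β : Branch fetch
    β = load ⨾ load ⨾ copy ⨾ inc ⨾ load

  body-finish : ∀ {s p us H K τ fs o} v → Rep s (toℕ v) [] H (frame p us K τ ∷ fs) o →
    HaltsWithin body s 40 (λ s′ → Rep s′ p us (comb K (ret H)) fs (returnTo τ (leave v H o)))
  body-finish v r = within (≤ᵇ⇒≤ 38 40 tt) (then-halts (fetch-halts r) λ s′ (r′ , r₄ , r₅ , r₆) →
    if-true (trans (cong₂ _≡ᵇ_ r₅ r₆) (proj₁ (proj₂ (Rep.top r′))))
      (then-halts (settle-halts v r′ r₄) λ s″ p →
        then-halts (combine-halts p) λ s‴ (r″ , r₁₀) → token-halts r″ r₁₀))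

  body-skip : ∀ {s v u us H g fs o} → Rep s v (u ∷ us) H (g ∷ fs) o → toℕ u ≡ Frame.vertex g →
    HaltsWithin body s 40 (λ s′ → Rep s′ v us H (g ∷ fs) o)
  body-skip r eq = within (≤ᵇ⇒≤ 14 40 tt) (then-halts (fetch-halts r) λ s′ (r′ , r₄ , r₅ , r₆) →
    if-false (trans (cong₂ _≡ᵇ_ r₅ r₆) (proj₁ (proj₁ (proj₂ (Rep.top r′)))))
      (then-halts (visit-halts r′ r₅) λ s″ (r″ , r₈ , r₉) →
        if-true (≡ᵇ-refl (trans r₈ (trans eq (sym r₉)))) (take-branch skip tt r″)))

  body-push : ∀ {s v u us H g fs o} → Rep s v (u ∷ us) H (g ∷ fs) o → toℕ u ≢ Frame.vertex g →
    HaltsWithin body s 40 (λ s′ → Rep s′ (toℕ u) (nbrs L u) 1 (frame v us H (Progress.token o) ∷ g ∷ fs) (descendInto u o))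
  body-push {u = u} r ne = within (≤ᵇ⇒≤ 33 40 tt) (then-halts (fetch-halts r) λ s′ (r′ , r₄ , r₅ , r₆) →
    if-false (trans (cong₂ _≡ᵇ_ r₅ r₆) (proj₁ (proj₁ (proj₂ (Rep.top r′)))))
      (then-halts (visit-halts r′ r₅) λ s″ (r″ , r₈ , r₉) →
        if-false (≡ᵇ-≢ (λ eq → ne (trans (sym r₈) (trans eq r₉)))) (push-halts u r″ r₈)))

  loop-test : ∀ {s v us H f fs o} → Rep s v us H (f ∷ fs) o → test (11 ≺ 3) s ≡ true
  loop-test (rep (_ , _ , r₁₁ , _) depth _ _ _ _) = cong₂ _<ᵇ_ r₁₁ depth

  -- The loop is followed along the recursion of `scanS`. One turn costs at most 40 steps in `body`
  -- and 1 for the test.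
  scan-reach : ∀ {p v us H} (t : Trav p v us) {s g fs o} → Rep s (toℕ v) us H (g ∷ fs) o → Frame.vertex g ≡ p →
    Reach s (turns t * 41) (λ s′ → Rep s′ (toℕ v) [] (scanH t H) (g ∷ fs) (scanS t o))
  scan-reach [] r _ = stay r
  scan-reach (skip e t) r eq =
    once (loop-test r) (body-skip r (trans e (sym eq))) then λ s′ r′ → scan-reach t r′ eq
  scan-reach {v = v} (down {u = u} ne e c t) r eq =
    reach-≤ (≤-reflexive (cong (41 +_) (sym (*-distribʳ-+ 41 (turns c) (suc (turns t))))))
      (once (loop-test r) (body-push r (λ e′ → ne (trans e′ eq))) then λ s₁ r₁ →
        scan-reach c r₁ refl then λ s₂ r₂ →
        once (loop-test r₂) (body-finish u r₂) then λ s₃ r₃ →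
        scan-reach t r₃ eq)

  -- The root returns into the sentinel, and the existentials stand for what this leaves in the
  -- sentinel's frame.
  tree-reach : ∀ {v s g o} (t : Trav n v (nbrs L v)) → Rep s (toℕ v) (nbrs L v) 1 (g ∷ []) (descendInto v o) →
    Frame.vertex g ≡ n →
    HaltsWithin (while (11 ≺ 3) body) s (suc (turns t * 41 + 41))
      (λ s′ → ∃[ p ] ∃[ us ] ∃[ H ] ∃[ τ ] Rep s′ p us H [] (record (visitS t o) { token = τ }))
  tree-reach {v} t r eq =
    exit (scan-reach t r eq then λ s₁ r₁ → once (loop-test r₁) (body-finish v r₁))
      λ s₂ r₂ → cong₂ _<ᵇ_ (proj₁ (proj₂ (proj₂ (Rep.static r₂)))) (Rep.depth r₂) , _ , _ , _ , _ , r₂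

  dfs-halts : ∀ {s S} root → toℕ root ≡ 0 → (t : Trav n root (nbrs L root)) → off (suc n) ≡ 0 →
    reg s 0 ≡ n → reg s 7 ≡ m₇ → (∀ j → arr s 0 j ≡ off j) → (∀ j → arr s 1 j ≡ cells j) →
    (∀ j → arr s 3 j ≡ a₃ j) → (∀ j → arr s 6 j ≡ a₆ j) → (∀ j → arr s 7 j ≡ a₇ j) →
    SetRep (arr s 2) S → reg s 1 ≡ 0 →
    HaltsWithin (dfs k) s (9 + (20 + suc (turns t * 41 + 41)))
      (λ s′ → Static s′ × SetRep (arr s′ 2) (Progress.cover (visitS t (progress S nothing [])))
                        × Log s′ (Progress.jumps (visitS t (progress S nothing []))))
  dfs-halts {s} {S} root root≡0 t end r₀ r₇ a₀ a₁ e₃ e₆ e₇ set r₁ =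
    then-halts {b = 9} {Q = λ s₁ → Rep s₁ n [] k [] o × reg s₁ 8 ≡ toℕ root}
      (take-branch start-up tt started) λ s₁ (r , r₈) →
    then-halts (push-halts root r r₈) λ s₂ r′ →
    finally (tree-reach {o = o} t r′ refl)
    where
    start-up : Branch _
    start-up = const ⨾ const ⨾ const ⨾ store ⨾ store ⨾ store ⨾ store ⨾ store ⨾ const
    o = progress S nothing []
    started : Rep (exec start-up s) n [] k [] o × 0 ≡ toℕ root
    started = rep (r₀ , refl , refl , r₇ , a₀ , a₁ , e₃ , e₆ , e₇) refl
                (r₀ , ≡ᵇ-refl (sym end) , refl , sym (n∸n≡0 k) , r₀) tt set (r₁ , (tt , tt)) , sym root≡0
    finally : ∀ {P s m} →
      HaltsWithin P s m (λ s′ → ∃[ p ] ∃[ us ] ∃[ H ] ∃[ τ ] Rep s′ p us H [] (record (visitS t o) { token = τ })) →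
      HaltsWithin P s m (λ s′ → Static s′ × SetRep (arr s′ 2) (Progress.cover (visitS t o)) × Log s′ (Progress.jumps (visitS t o)))
    finally (s′ , u , d , le , _ , _ , _ , _ , rep st _ _ _ set log) = s′ , u , d , le , st , set , log

-- Renaming registers and arrays.

relabelTest : (ℕ → ℕ) → Test → Test
relabelTest ρ (r ≐ q) = ρ r ≐ ρ q
relabelTest ρ (r ≺ q) = ρ r ≺ ρ q

relabel : (ρ α : ℕ → ℕ) → Program → Program
relabel ρ α skip           = skip
relabel ρ α (const r v)    = const (ρ r) v
relabel ρ α (copy r q)     = copy (ρ r) (ρ q)
relabel ρ α (inc r)        = inc (ρ r)
relabel ρ α (dec r)        = dec (ρ r)
relabel ρ α (load r a i)   = load (ρ r) (α a) (ρ i)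
relabel ρ α (store a i r)  = store (α a) (ρ i) (ρ r)
relabel ρ α (P ⨾ Q)        = relabel ρ α P ⨾ relabel ρ α Q
relabel ρ α (ifThen b P Q) = ifThen (relabelTest ρ b) (relabel ρ α P) (relabel ρ α Q)
relabel ρ α (while b P)    = while (relabelTest ρ b) (relabel ρ α P)

module Relabel (ρ α : ℕ → ℕ) (ρ-inv : ∀ x → ρ (ρ x) ≡ x) (α-inv : ∀ x → α (α x) ≡ x) where

  Relabelled : State → State → Set
  Relabelled s u = (∀ r → reg u (ρ r) ≡ reg s r) × (∀ a i → arr u (α a) i ≡ arr s a i)

  involution-≡ᵇ : ∀ (σ : ℕ → ℕ) → (∀ x → σ (σ x) ≡ x) → ∀ a b → (σ a ≡ᵇ σ b) ≡ (a ≡ᵇ b)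
  involution-≡ᵇ σ inv a b with a ≟ b
  ... | yes refl = trans (≡ᵇ-refl {σ a} refl) (sym (≡ᵇ-refl {a} refl))
  ... | no ne    = trans (≡ᵇ-≢ (λ e → ne (trans (sym (inv a)) (trans (cong σ e) (inv b))))) (sym (≡ᵇ-≢ ne))

  relabelled-setReg : ∀ {s} u {x y} r → Relabelled s u → y ≡ x → Relabelled (setReg r x s) (setReg (ρ r) y u)
  relabelled-setReg {s} u {x} {y} r (R , A) eq = at , A
    where
    at : ∀ q → (if ρ q ≡ᵇ ρ r then y else reg u (ρ q)) ≡ (if q ≡ᵇ r then x else reg s q)
    at q rewrite involution-≡ᵇ ρ ρ-inv q r | eq | R q = refl

  relabelled-setArr : ∀ {s} u {i j x y} a → Relabelled s u → j ≡ i → y ≡ x →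
                      Relabelled (setArr a i x s) (setArr (α a) j y u)
  relabelled-setArr {s} u {i} {j} {x} {y} a (R , A) eq eq′ = R , at
    where
    at : ∀ b l → (if α b ≡ᵇ α a then (if l ≡ᵇ j then y else arr u (α b) l) else arr u (α b) l) ≡
                 (if b ≡ᵇ a then (if l ≡ᵇ i then x else arr s b l) else arr s b l)
    at b l rewrite involution-≡ᵇ α α-inv b a | eq | eq′ | A b l = refl

  relabelled-test : ∀ {s u c} b → Relabelled s u → test b s ≡ c → test (relabelTest ρ b) u ≡ c
  relabelled-test (r ≐ q) (R , _) eq = trans (cong₂ _≡ᵇ_ (R r) (R q)) eq
  relabelled-test (r ≺ q) (R , _) eq = trans (cong₂ _<ᵇ_ (R r) (R q)) eq

  -- An involution is injective, so distinct registers and arrays stay distinct and every update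
  -- hits exactly the corresponding cell.
  relabel-run : ∀ {P s s′ t u} → ⟪ P , s ⟫⇓ s′ ∣ t → Relabelled s u →
                ∃[ u′ ] ⟪ relabel ρ α P , u ⟫⇓ u′ ∣ t × Relabelled s′ u′
  relabel-run skip R = _ , skip , R
  relabel-run {u = u} (const {r}) R = _ , const , relabelled-setReg u r R refl
  relabel-run {u = u} (copy {r} {q}) R = _ , copy , relabelled-setReg u r R (proj₁ R q)
  relabel-run {u = u} (inc {r}) R = _ , inc , relabelled-setReg u r R (cong suc (proj₁ R r))
  relabel-run {u = u} (dec {r}) R = _ , dec , relabelled-setReg u r R (cong pred (proj₁ R r))
  relabel-run {u = u} (load {r} {a} {i}) R =
    _ , load , relabelled-setReg u r R (trans (cong (arr u (α a)) (proj₁ R i)) (proj₂ R a _))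
  relabel-run {u = u} (store {a} {i} {r}) R = _ , store , relabelled-setArr u a R (proj₁ R i) (proj₁ R r)
  relabel-run (d ⨾ e) R with relabel-run d R
  ... | u′ , d′ , R′ with relabel-run e R′
  ...   | u″ , e′ , R″ = u″ , (d′ ⨾ e′) , R″
  relabel-run (ifTrue {b} tr d) R with relabel-run d R
  ... | u′ , d′ , R′ = u′ , ifTrue (relabelled-test b R tr) d′ , R′
  relabel-run (ifFalse {b} fa d) R with relabel-run d R
  ... | u′ , d′ , R′ = u′ , ifFalse (relabelled-test b R fa) d′ , R′
  relabel-run (done {b} fa) R = _ , done (relabelled-test b R fa) , R
  relabel-run (loop {b} tr d e) R with relabel-run d R
  ... | u′ , d′ , R′ with relabel-run e R′
  ...   | u″ , e′ , R″ = u″ , loop (relabelled-test b R tr) d′ e′ , R″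

  relabel-halts : ∀ {P u m Q} → HaltsWithin P ⟨ reg u ∘ ρ , arr u ∘ α ⟩ m Q →
                  HaltsWithin (relabel ρ α P) u m (λ u′ → ∃[ s′ ] Relabelled s′ u′ × Q s′)
  relabel-halts (s′ , t , d , le , q) with relabel-run d ((λ _ → refl) , λ _ _ → refl)
  ... | u′ , d′ , R = u′ , t , d′ , le , s′ , R , q

-- The layout of the input.

cell-++ : ∀ {n} (pre : List (Fin n)) {u rest} → cell (map toℕ (pre ++ u ∷ rest)) (length pre) ≡ toℕ u
cell-++ []        = refl
cell-++ (_ ∷ pre) = cell-++ pre

seg-cells : ∀ {n} (pre us rest : List (Fin n)) {i e xs} → xs ≡ pre ++ us ++ rest → i ≡ length pre →
            e ≡ length pre + length us → Seg (cell (map toℕ xs)) i e us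
seg-cells pre [] rest refl refl refl = ≡ᵇ-refl (sym (+-identityʳ (length pre)))
seg-cells pre (u ∷ us) rest refl refl refl =
    ≡ᵇ-≢ (<⇒≢ (m<m+n (length pre) z<s))
  , cell-++ pre
  , seg-cells (pre ++ [ u ]) us rest (sym (++-assoc pre [ u ] (us ++ rest))) (sym len)
      (trans (+-suc (length pre) (length us)) (cong (_+ length us) (sym len)))
  where
  len : length (pre ++ [ u ]) ≡ suc (length pre)
  len = trans (length-++ pre) (+-comm (length pre) 1)

concat-tabulate : ∀ {A : Set} {m} (f : Fin m → List A) v → ∃[ pre ] ∃[ rest ]
  concat (tabulate f) ≡ pre ++ f v ++ rest × length (concat (take (toℕ v) (tabulate f))) ≡ length pre ×
  length (concat (take (suc (toℕ v)) (tabulate f))) ≡ length pre + length (f v)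
concat-tabulate f zero = [] , _ , refl , refl , trans (length-++ (f zero)) (+-identityʳ (length (f zero)))
concat-tabulate f (suc v) with concat-tabulate (f ∘ suc) v
... | pre , rest , eq , l₁ , l₂ =
  f zero ++ pre , rest
  , trans (cong (f zero ++_) eq) (sym (++-assoc (f zero) pre _))
  , trans (length-++ (f zero)) (trans (cong (length (f zero) +_) l₁) (sym (length-++ (f zero))))
  , trans (length-++ (f zero)) (trans (cong (length (f zero) +_) l₂)
      (trans (sym (+-assoc (length (f zero)) (length pre) _)) (cong (_+ length (f (suc v))) (sym (length-++ (f zero))))))

<ᵇ-true : ∀ {a b} → a < b → (a <ᵇ b) ≡ true
<ᵇ-true {a} {b} lt with a <ᵇ b in e
... | true  = refl
... | false = ⊥-elim (subst T e (<⇒<ᵇ lt))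

<ᵇ-irrefl : ∀ a → (a <ᵇ a) ≡ false
<ᵇ-irrefl zero    = refl
<ᵇ-irrefl (suc a) = <ᵇ-irrefl a

module _ {n : ℕ} {G : Graph n} (L : AdjacencyLists G) (I J : Subset n) where

  input-seg : ∀ v → Seg (arr (input L I J) 1) (arr (input L I J) 0 (toℕ v)) (arr (input L I J) 0 (suc (toℕ v))) (nbrs L v)
  input-seg v with concat-tabulate (nbrs L) v
  ... | pre , rest , eq , l₁ , l₂ rewrite <ᵇ-true {toℕ v} {suc n} (m≤n⇒m≤1+n (Fin.toℕ<n v)) | <ᵇ-true (Fin.toℕ<n v) =
    seg-cells pre (nbrs L v) rest eq l₁ l₂

  input-end : arr (input L I J) 0 (suc n) ≡ 0
  input-end rewrite <ᵇ-irrefl n = refl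

setRep-indicator : ∀ {n} (S : Subset n) → SetRep (cell (indicator S)) S
setRep-indicator (b ∷ S) zero    = refl
setRep-indicator (b ∷ S) (suc w) = setRep-indicator S w

-- Comparing cardinalities.

countBody : Program
countBody =
  load 8 2 3 ⨾ ifThen (11 ≺ 8) (inc 4) skip ⨾
  load 8 3 3 ⨾ ifThen (11 ≺ 8) (inc 5) skip ⨾ inc 3

module Counting where
  open Loop (3 ≺ 0) countBody

  Counts : ℕ → ℕ → ℕ → State → Set
  Counts i a b s = reg s 3 ≡ i × reg s 4 ≡ a × reg s 5 ≡ b

  Suffix : ∀ {r} → (ℕ → ℕ) → ℕ → Subset r → Set
  Suffix f i S = ∀ w → f (i + toℕ w) ≡ bit (lookup S w)

  suffix-head : ∀ {r} f {i b} {S : Subset r} → Suffix f i (b ∷ S) → f i ≡ bit b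
  suffix-head f {i} suf = trans (cong f (sym (+-identityʳ i))) (suf zero)

  suffix-tail : ∀ {r} f {i b} {S : Subset r} → Suffix f i (b ∷ S) → Suffix f (suc i) S
  suffix-tail f {i} suf w = trans (cong f (sym (+-suc i (toℕ w)))) (suf (suc w))

  add : Bool → ℕ → ℕ
  add b a = if b then suc a else a

  module _ (n : ℕ) (f₂ f₃ : ℕ → ℕ) where

    Fixed : State → Set
    Fixed s = reg s 0 ≡ n × reg s 11 ≡ 0 × (∀ j → arr s 2 j ≡ f₂ j) × (∀ j → arr s 3 j ≡ f₃ j)

    count-step : ∀ {s i a b} p q → Fixed s → Counts i a b s → f₂ i ≡ bit p → f₃ i ≡ bit q →
      HaltsWithin countBody s 7 (λ s′ → Fixed s′ × Counts (suc i) (add p a) (add q b) s′)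
    count-step {s} {i} p q fx@(r₀ , r₁₁ , e₂ , e₃) (refl , refl , refl) pi qi = go p q pi qi
      where
      tested : ∀ {x} b → x ≡ bit b → (reg s 11 <ᵇ x) ≡ b
      tested true  refl = cong (_<ᵇ 1) r₁₁
      tested false refl = cong (_<ᵇ 0) r₁₁
      go : ∀ p q → f₂ (reg s 3) ≡ bit p → f₃ (reg s 3) ≡ bit q →
        HaltsWithin countBody s 7 (λ s′ → Fixed s′ × Counts (suc (reg s 3)) (add p (reg s 4)) (add q (reg s 5)) s′)
      go true true pi qi = take-branch (load ⨾ ifTrue inc ⨾ load ⨾ ifTrue inc ⨾ inc)
        (tested true (trans (e₂ _) pi) , tested true (trans (e₃ _) qi) , tt) (fx , refl , refl , refl)
      go true false pi qi = take-branch (load ⨾ ifTrue inc ⨾ load ⨾ ifFalse skip ⨾ inc)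
        (tested true (trans (e₂ _) pi) , tested false (trans (e₃ _) qi) , tt) (fx , refl , refl , refl)
      go false true pi qi = take-branch (load ⨾ ifFalse skip ⨾ load ⨾ ifTrue inc ⨾ inc)
        (tested false (trans (e₂ _) pi) , tested true (trans (e₃ _) qi) , tt) (fx , refl , refl , refl)
      go false false pi qi = take-branch (load ⨾ ifFalse skip ⨾ load ⨾ ifFalse skip ⨾ inc)
        (tested false (trans (e₂ _) pi) , tested false (trans (e₃ _) qi) , tt) (fx , refl , refl , refl)

    add-card : ∀ {r} b (S : Subset r) a → ∣ S ∣ + add b a ≡ ∣ b ∷ S ∣ + a
    add-card true  S a = +-suc ∣ S ∣ a
    add-card false S a = refl

    count-reach : ∀ {r} (A B : Subset r) {s i a b} → i + r ≡ n → Suffix f₂ i A → Suffix f₃ i B → Fixed s → Counts i a b s →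
      Reach s (r * 8) (λ s′ → Fixed s′ × Counts n (∣ A ∣ + a) (∣ B ∣ + b) s′)
    count-reach [] [] {i = i} eq _ _ fx (e , cs) = stay (fx , trans e (trans (sym (+-identityʳ i)) eq) , cs)
    count-reach {suc r} (p ∷ A) (q ∷ B) {s} {i} {a} {b} eq sA sB fx@(r₀ , _) cs@(e , _) =
      once (trans (cong₂ _<ᵇ_ e r₀) (<ᵇ-true (subst (i <_) eq (m<m+n i z<s))))
           (count-step p q fx cs (suffix-head f₂ {S = A} sA) (suffix-head f₃ {S = B} sB)) then λ s₁ (fx₁ , cs₁) →
      subst₂ (λ x y → Reach s₁ (r * 8) (λ s′ → Fixed s′ × Counts n x y s′)) (add-card p A a) (add-card q B b)
        (count-reach A B (trans (sym (+-suc i r)) eq) (suffix-tail f₂ {S = A} sA) (suffix-tail f₃ {S = B} sB) fx₁ cs₁)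

compareSizes : Program
compareSizes = zeros ⨾ while (3 ≺ 0) countBody ⨾ ifThen (4 ≐ 5) (const 1 1) (const 1 0)
  where
  zeros = const 11 0 ⨾ const 3 0 ⨾ const 4 0 ⨾ const 5 0

compareSizes-halts : ∀ {n s} {A B : Subset n} → reg s 0 ≡ n → SetRep (arr s 2) A → SetRep (arr s 3) B →
  HaltsWithin compareSizes s (4 + (suc (n * 8) + 2)) (λ s′ → reg s′ 1 ≡ (if ∣ A ∣ ≡ᵇ ∣ B ∣ then 1 else 0))
compareSizes-halts {n} {s} {A} {B} r₀ sA sB =
  then-halts {b = 4} {Q = λ s₁ → Fixed n (arr s 2) (arr s 3) s₁ × Counts 0 0 0 s₁}
    (take-branch (const ⨾ const ⨾ const ⨾ const) tt ((r₀ , refl , (λ _ → refl) , λ _ → refl) , refl , refl , refl))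
    λ s₁ (fx , cs) →
  then-halts (exit (count-reach n (arr s 2) (arr s 3) A B refl sA sB fx cs)
                λ s₂ (fx₂ , cs₂) → trans (cong₂ _<ᵇ_ (proj₁ cs₂) (proj₁ fx₂)) (<ᵇ-irrefl n) , proj₂ cs₂)
    λ s₂ (e₄ , e₅) → answer s₂ (trans e₄ (+-identityʳ _)) (trans e₅ (+-identityʳ _))
  where
  open Counting
  open Loop (3 ≺ 0) countBody
  answer : ∀ s → reg s 4 ≡ ∣ A ∣ → reg s 5 ≡ ∣ B ∣ →
    HaltsWithin (ifThen (4 ≐ 5) (const 1 1) (const 1 0)) s 2 (λ s′ → reg s′ 1 ≡ (if ∣ A ∣ ≡ᵇ ∣ B ∣ then 1 else 0))
  answer s e₄ e₅ with ∣ A ∣ ≡ᵇ ∣ B ∣ in eq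
  ... | true  = take-branch (ifTrue const) (trans (cong₂ _≡ᵇ_ e₄ e₅) eq , tt) refl
  ... | false = take-branch (ifFalse const) (trans (cong₂ _≡ᵇ_ e₄ e₅) eq , tt) refl

-- Undoing the jumps of the second search.

reverseBody : Program
reverseBody = dec 7 ⨾ load 8 6 7 ⨾ load 9 7 7 ⨾ store 4 1 9 ⨾ store 5 1 8 ⨾ inc 1

module Reversing {n : ℕ} where
  open Loop (11 ≺ 7) reverseBody

  Reversal : List (Fin n × Fin n) → List (Fin n × Fin n) → State → Set
  Reversal l acc s = reg s 11 ≡ 0 × reg s 7 ≡ length l × Logged (arr s 6) (arr s 7) l ×
                     reg s 1 ≡ length acc × Logged (arr s 4) (arr s 5) acc

  -- The log is consumed from its end and arrays 6 and 7 exchange roles, which is the order and the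
  -- form in which `unwind` undoes jumps.
  reverse-step : ∀ {s x y l acc} → Reversal ((x , y) ∷ l) acc s →
                 HaltsWithin reverseBody s 6 (Reversal l ((y , x) ∷ acc))
  reverse-step {s} {x} {y} {l} {acc} (r₁₁ , r₇ , ((x≡ , X) , (y≡ , Y)) , r₁ , log) =
    take-branch (dec ⨾ load ⨾ load ⨾ store ⨾ store ⨾ inc) tt
      ( r₁₁ , cong pred r₇ , (X , Y) , cong suc r₁
      , logged-put acc log r₁
          (trans (cong (arr s 7) (trans (cong pred r₇) (sym (length-map (toℕ ∘ proj₂) l)))) y≡)
          (trans (cong (arr s 6) (trans (cong pred r₇) (sym (length-map (toℕ ∘ proj₁) l)))) x≡))

  reverse-reach : ∀ l {acc s} → Reversal l acc s → Reach s (length l * 7) (Reversal [] (map swap l ʳ++ acc))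
  reverse-reach []            R = stay R
  reverse-reach ((x , y) ∷ l) R@(r₁₁ , r₇ , _) =
    once (cong₂ _<ᵇ_ r₁₁ r₇) (reverse-step R) then λ s₁ R₁ → reverse-reach l R₁

  reverse-halts : ∀ l {acc s} → Reversal l acc s →
    HaltsWithin (while (11 ≺ 7) reverseBody) s (suc (length l * 7)) (Reversal [] (map swap l ʳ++ acc))
  reverse-halts l R = exit (reverse-reach l R) λ s R → cong₂ _<ᵇ_ (proj₁ R) (proj₁ (proj₂ R)) , R

-- Listing the differences of two sets.

differenceBody : Program
differenceBody =
  load 8 2 3 ⨾ load 9 3 3 ⨾
  ifThen (8 ≐ 9) skip
    (ifThen (9 ≺ 8) (store 4 4 3 ⨾ inc 4) (store 5 5 3 ⨾ inc 5)) ⨾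
  inc 3

module Difference {n : ℕ} (A B : Subset n) (l lJ : List (Fin n × Fin n)) where
  open Loop (3 ≺ 0) differenceBody

  record ListsBelow (m : ℕ) (xs : List (Fin n)) (P Q : Subset n) : Set where
    field
      unique   : Unique xs
      sound    : ∀ {w} → w ∈ xs → toℕ w < m × lookup P w ≡ true × lookup Q w ≡ false
      complete : ∀ {w} → toℕ w < m → lookup P w ≡ true → lookup Q w ≡ false → w ∈ xs

  lists-start : ∀ {P Q} → ListsBelow 0 [] P Q
  lists-start = record { unique = [] ; sound = λ () ; complete = λ () }

  lists-end : ∀ {xs P Q} → ListsBelow n xs P Q → Lists xs P Q
  lists-end X = record { unique = ListsBelow.unique X ; sound = proj₂ ∘ ListsBelow.sound X
                       ; complete = ListsBelow.complete X (Fin.toℕ<n _) }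

  below-suc : ∀ {m} (v : Fin n) → toℕ v ≡ m → ∀ {w : Fin n} → toℕ w < suc m → w ≢ v → toℕ w < m
  below-suc v refl {w} lt ne = ≤∧≢⇒< (s≤s⁻¹ lt) (ne ∘ Fin.toℕ-injective)

  lists-keep : ∀ {m xs P Q} v → toℕ v ≡ m → ¬ (lookup P v ≡ true × lookup Q v ≡ false) →
               ListsBelow m xs P Q → ListsBelow (suc m) xs P Q
  lists-keep {xs = xs} {P} {Q} v v≡ no-v X = record
    { unique = ListsBelow.unique X
    ; sound = λ w∈ → let (a , b) = ListsBelow.sound X w∈ in m≤n⇒m≤1+n a , b
    ; complete = λ {w} lt p q → ListsBelow.complete X
        (below-suc v v≡ lt (λ { refl → no-v (p , q) })) p q }

  lists-add : ∀ {m xs P Q} v → toℕ v ≡ m → lookup P v ≡ true → lookup Q v ≡ false →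
              ListsBelow m xs P Q → ListsBelow (suc m) (v ∷ xs) P Q
  lists-add {m} {xs} {P} {Q} v refl vP vQ X = record
    { unique = All∉ (λ v∈ → <-irrefl refl (proj₁ (ListsBelow.sound X v∈))) ∷ ListsBelow.unique X
    ; sound = λ { (here refl) → ≤-refl , vP , vQ
                ; (there w∈) → let (a , b) = ListsBelow.sound X w∈ in m≤n⇒m≤1+n a , b }
    ; complete = complete }
    where
    complete : ∀ {w} → toℕ w < suc m → lookup P w ≡ true → lookup Q w ≡ false → w ∈ v ∷ xs
    complete {w} lt p q with w Fin.≟ v
    ... | yes eq = here eq
    ... | no ne  = there (ListsBelow.complete X (below-suc v refl lt ne) p q)

  Fixed : State → Set
  Fixed s = reg s 0 ≡ n × reg s 11 ≡ 0 × SetRep (arr s 2) A × SetRep (arr s 3) B × reg s 7 ≡ length lJ × Logged (arr s 6) (arr s 7) lJ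

  Sources Targets : List (Fin n) → List ℕ
  Sources xs = map toℕ xs ++ map (toℕ ∘ proj₁) l
  Targets ys = map toℕ ys ++ map (toℕ ∘ proj₂) l

  -- Sources and targets grow behind the first log with separate counters and are paired by position
  -- only. That the counters finally agree comes from `exchange` and equal cardinalities.
  Found : ℕ → State → Set
  Found m s = Fixed s × reg s 3 ≡ m ×
    (∃[ xs ] ListsBelow m xs A B × reg s 4 ≡ length (Sources xs) × Holds (arr s 4) (Sources xs)) ×
    (∃[ ys ] ListsBelow m ys B A × reg s 5 ≡ length (Targets ys) × Holds (arr s 5) (Targets ys))

  difference-step : ∀ {s} v → Found (toℕ v) s → HaltsWithin differenceBody s 7 (Found (suc (toℕ v)))
  difference-step {s} v (fx@(r₀ , _ , sA , sB , _) , r₃ , (xs , X , r₄ , hX) , (ys , Y , r₅ , hY)) =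
    go (lookup A v) (lookup B v) refl refl
    where
    bits : ∀ {a b} (_~_ : ℕ → ℕ → Bool) → lookup A v ≡ a → lookup B v ≡ b →
           (arr s 2 (reg s 3) ~ arr s 3 (reg s 3)) ≡ (bit a ~ bit b)
    bits _~_ vA vB = cong₂ _~_ (trans (cong (arr s 2) r₃) (trans (sA v) (cong bit vA)))
                               (trans (cong (arr s 3) r₃) (trans (sB v) (cong bit vB)))
    same : ∀ {b} {P Q : Subset n} → lookup P v ≡ b → lookup Q v ≡ b → ¬ (lookup P v ≡ true × lookup Q v ≡ false)
    same vP vQ (p , q) = contradiction (trans (sym p) (trans vP (trans (sym vQ) q))) λ ()
    first : ∀ {P Q : Subset n} → lookup P v ≡ false → ¬ (lookup P v ≡ true × lookup Q v ≡ false)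
    first vP (p , _) = contradiction (trans (sym p) vP) λ ()
    go : ∀ a b → lookup A v ≡ a → lookup B v ≡ b → HaltsWithin differenceBody s 7 (Found (suc (toℕ v)))
    go true true vA vB = take-branch (load ⨾ load ⨾ ifTrue skip ⨾ inc) (bits _≡ᵇ_ vA vB , tt)
      (fx , cong suc r₃ , (xs , lists-keep v refl (same {P = A} {B} vA vB) X , r₄ , hX)
                        , (ys , lists-keep v refl (same {P = B} {A} vB vA) Y , r₅ , hY))
    go false false vA vB = take-branch (load ⨾ load ⨾ ifTrue skip ⨾ inc) (bits _≡ᵇ_ vA vB , tt)
      (fx , cong suc r₃ , (xs , lists-keep v refl (same {P = A} {B} vA vB) X , r₄ , hX)
                        , (ys , lists-keep v refl (same {P = B} {A} vB vA) Y , r₅ , hY))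
    go true false vA vB = take-branch (load ⨾ load ⨾ ifFalse (ifTrue (store ⨾ inc)) ⨾ inc)
      (bits _≡ᵇ_ vA vB , bits (λ a b → b <ᵇ a) vA vB , tt)
      (fx , cong suc r₃ , (v ∷ xs , lists-add v refl vA vB X , cong suc r₄ , holds-put (Sources xs) hX r₄ r₃)
                        , (ys , lists-keep v refl (first {P = B} {A} vB) Y , r₅ , hY))
    go false true vA vB = take-branch (load ⨾ load ⨾ ifFalse (ifFalse (store ⨾ inc)) ⨾ inc)
      (bits _≡ᵇ_ vA vB , bits (λ a b → b <ᵇ a) vA vB , tt)
      (fx , cong suc r₃ , (xs , lists-keep v refl (first {P = A} {B} vA) X , r₄ , hX)
                        , (v ∷ ys , lists-add v refl vB vA Y , cong suc r₅ , holds-put (Targets ys) hY r₅ r₃))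

  difference-reach : ∀ r {m s} → m + r ≡ n → Found m s → Reach s (r * 8) (Found n)
  difference-reach zero    {m} {s} eq F = stay (subst (λ m → Found m s) (trans (sym (+-identityʳ m)) eq) F)
  difference-reach (suc r) {m} {s} eq F =
    once (trans (cong₂ _<ᵇ_ (proj₁ (proj₂ F)) (proj₁ (proj₁ F))) (<ᵇ-true m<n))
      (subst (λ m → HaltsWithin differenceBody s 7 (Found (suc m))) (Fin.toℕ-fromℕ< m<n)
        (difference-step (fromℕ< m<n) (subst (λ m → Found m s) (sym (Fin.toℕ-fromℕ< m<n)) F))) then λ s₁ F₁ →
    difference-reach r (trans (sym (+-suc m r)) eq) F₁
    where
    m<n : m < n
    m<n = subst (m <_) eq (m<m+n m z<s)

  difference-halts : ∀ {s} → Found 0 s → HaltsWithin (while (3 ≺ 0) differenceBody) s (suc (n * 8)) (Found n)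
  difference-halts F = exit (difference-reach n refl F)
    λ s F → trans (cong₂ _<ᵇ_ (proj₁ (proj₂ F)) (proj₁ (proj₁ F))) (<ᵇ-irrefl n) , F

-- Renumbering dfs in this way makes it work on J and log in arrays 6 and 7.
swapReg swapArr : ℕ → ℕ
swapReg 1 = 7
swapReg 7 = 1
swapReg r = r
swapArr 2 = 3
swapArr 3 = 2
swapArr 4 = 6
swapArr 5 = 7
swapArr 6 = 4
swapArr 7 = 5
swapArr a = a

swapReg-inv : ∀ r → swapReg (swapReg r) ≡ r
swapReg-inv 0 = refl
swapReg-inv 1 = refl
swapReg-inv 2 = refl
swapReg-inv 3 = refl
swapReg-inv 4 = refl
swapReg-inv 5 = refl
swapReg-inv 6 = refl
swapReg-inv 7 = refl
swapReg-inv (suc (suc (suc (suc (suc (suc (suc (suc r)))))))) = refl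

swapArr-inv : ∀ a → swapArr (swapArr a) ≡ a
swapArr-inv 0 = refl
swapArr-inv 1 = refl
swapArr-inv 2 = refl
swapArr-inv 3 = refl
swapArr-inv 4 = refl
swapArr-inv 5 = refl
swapArr-inv 6 = refl
swapArr-inv 7 = refl
swapArr-inv (suc (suc (suc (suc (suc (suc (suc (suc a)))))))) = refl

-- The construction program and its time bound.

initDifference joinRuns : Program
initDifference = const 11 0 ⨾ const 3 0 ⨾ copy 4 1 ⨾ copy 5 1
joinRuns = initDifference ⨾ while (3 ≺ 0) differenceBody ⨾ copy 1 4 ⨾ while (11 ≺ 7) reverseBody

construct : ℕ → Program
construct k = dfs k ⨾ relabel swapReg swapArr (dfs k) ⨾ joinRuns

logged-zip : ∀ {n f g} (xs ys : List (Fin n)) l → length xs ≡ length ys →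
             Holds f (map toℕ xs ++ map (toℕ ∘ proj₁) l) → Holds g (map toℕ ys ++ map (toℕ ∘ proj₂) l) →
             Logged f g (zip xs ys ++ l)
logged-zip {f = f} {g} xs ys l eq hX hY = subst (Holds f) (lefts xs ys eq) hX , subst (Holds g) (rights xs ys eq) hY
  where
  lefts : ∀ xs ys → length xs ≡ length ys → map toℕ xs ++ map (toℕ ∘ proj₁) l ≡ map (toℕ ∘ proj₁) (zip xs ys ++ l)
  lefts []       []       _  = refl
  lefts (x ∷ xs) (y ∷ ys) eq = cong (toℕ x ∷_) (lefts xs ys (suc-injective eq))
  rights : ∀ xs ys → length xs ≡ length ys → map toℕ ys ++ map (toℕ ∘ proj₂) l ≡ map (toℕ ∘ proj₂) (zip xs ys ++ l)
  rights []       []       _  = refl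
  rights (x ∷ xs) (y ∷ ys) eq = cong (toℕ y ∷_) (rights xs ys (suc-injective eq))

output-sequence : ∀ {n k} {G : Graph n} {I J l s} → Runs.Run k G I l J → Runs.Cover k G J → reg s 1 ≡ length l →
  Logged (arr s 4) (arr s 5) l → Σ[ S ∈ TJSequence k G I J ] OutputsSequence S s
output-sequence {k = k} {G} {l = l} {s} run cov r₁ (X , Y) =
    sequence (forward run (stop cov))
  , trans r₁ (sym (trans (length-ʳ++ l) (+-identityʳ (length l))))
  , holds-ʳ++ {f = arr s 4} (toℕ ∘ proj₁) l [] X (λ ())
  , holds-ʳ++ {f = arr s 5} (toℕ ∘ proj₂) l [] Y (λ ())
  where
  open Sequences k G

-- With at least one vertex, the constant overhead is absorbed by the factor of `n`.
affine-≤ : ∀ a b {n} → 1 ≤ n → a + b * n ≤ (a + b) * n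
affine-≤ a b {n} 1≤n = ≤-trans (+-monoˡ-≤ (b * n) (subst (_≤ a * n) (*-identityʳ a) (*-monoʳ-≤ a 1≤n)))
                         (≤-reflexive (sym (*-distribʳ-+ n a b)))

root-of : ∀ {n} → NonZero n → Σ[ r ∈ Fin n ] toℕ r ≡ 0
root-of {suc n} _ = zero , refl

logged-cong : ∀ {n f g f′ g′} (l : List (Fin n × Fin n)) → (∀ j → f′ j ≡ f j) → (∀ j → g′ j ≡ g j) →
              Logged f g l → Logged f′ g′ l
logged-cong l ef eg (X , Y) = holds-cong (map (toℕ ∘ proj₁) l) (λ j _ → ef j) X , holds-cong (map (toℕ ∘ proj₂) l) (λ j _ → eg j) Y

module Construction (k : ℕ) (2≤k : 2 ≤ k) {n : ℕ} {G : Graph n} (L : AdjacencyLists G) (I J : Subset n)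
  (isTree : IsTree G) (coverI : IsPathVertexCover k G I) (coverJ : IsPathVertexCover k G J) (card : ∣ I ∣ ≡ ∣ J ∣) where

  open Runs k G
  open Sequences k G
  open Traversal L

  root : Fin n
  root = proj₁ (root-of (IsTree.nonempty isTree))

  open Canonical L k 2≤k (IsTree.connected isTree) (IsTree.acyclic isTree) root

  inp : State
  inp = input L I J

  lI lJ : List (Fin n × Fin n)
  lI = Progress.jumps (gathered I)
  lJ = Progress.jumps (gathered J)

  I* J* : Subset n
  I* = Progress.cover (gathered I)
  J* = Progress.cover (gathered J)

  1≤n : 1 ≤ n
  1≤n = ≤-trans (s≤s z≤n) tree-size

  dfs-time : 9 + (20 + suc (turns tree * 41 + 41)) ≤ 194 * n
  -- 71 is 9 for start-up, 20 for pushing the root, 41 for its return and 1 for the last test. With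
  -- at most `3 * n` turns of cost 41 this gives 194 = 71 + 123.
  dfs-time = ≤-trans (≤-reflexive (shape (turns tree)))
    (≤-trans (+-monoʳ-≤ 71 (*-monoʳ-≤ 41 bound)) (≤-trans (≤-reflexive (cong (71 +_) (sym (*-assoc 41 3 n)))) (affine-≤ 71 123 1≤n)))
    where
    shape : ∀ t → 9 + (20 + suc (t * 41 + 41)) ≡ 71 + 41 * t
    shape = solve-∀
    bound : turns tree ≤ 3 * n
    bound = ≤-trans (turns-≤ tree (AdjacencyLists.unique L root))
      (≤-trans (≤-trans (s≤s (m≤n+m (3 * size tree) 2)) (≤-reflexive (sym (*-suc 3 (size tree))))) (*-monoʳ-≤ 3 tree-size))

  open Difference I* J* lI lJ

  Done : State → Set
  Done s = Σ[ S ∈ TJSequence k G I J ] OutputsSequence S s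

  finish-halts : ∀ {s} → Found n s → HaltsWithin (copy 1 4 ⨾ while (11 ≺ 7) reverseBody) s (1 + suc (n * 7)) Done
  finish-halts {s} ((_ , r₁₁ , _ , _ , r₇ , log₇) , _ , (xs , X , r₄ , hX) , (ys , Y , _ , hY)) =
    within (s≤s (s≤s (*-monoˡ-≤ 7 (gathered-jumps J))))
      (then-halts {b = 1} {Q = Reversal lJ (zip xs ys ++ lI)}
        (take-branch copy tt
          (r₁₁ , r₇ , log₇ , trans r₄ lengths , logged-zip xs ys lI (proj₁ exchanged) hX hY))
        λ s₁ R → finally (reverse-halts lJ R))
    where
    open Reversing
    exchanged = exchange cut-covering xs ys J* (gathered-run coverI) (gathered-cuts coverI) (gathered-cuts coverJ)
      (lists-end X) (lists-end Y)
      (trans (run-card (gathered-run coverI)) (trans card (sym (run-card (gathered-run coverJ)))))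
    lengths : length (Sources xs) ≡ length (zip xs ys ++ lI)
    lengths = trans (length-++ (map toℕ xs)) (trans (cong₂ _+_ (trans (length-map toℕ xs) (sym (zipped xs ys (proj₁ exchanged)))) (length-map (toℕ ∘ proj₁) lI))
                (sym (length-++ (zip xs ys))))
      where
      zipped : ∀ (xs ys : List (Fin n)) → length xs ≡ length ys → length (zip xs ys) ≡ length xs
      zipped []       []       _  = refl
      zipped (_ ∷ xs) (_ ∷ ys) eq = cong suc (zipped xs ys (suc-injective eq))
    finally : ∀ {P s m} → HaltsWithin P s m (Reversal [] (map swap lJ ʳ++ (zip xs ys ++ lI))) → HaltsWithin P s m Done
    finally (s′ , t , d , le , _ , _ , _ , r₁ , log) =
      s′ , t , d , le , output-sequence {s = s′} (unwind (gathered-run coverJ) (proj₂ exchanged)) coverJ r₁ log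

  joinRuns-halts : ∀ {s} → reg s 0 ≡ n → SetRep (arr s 2) I* → SetRep (arr s 3) J* → reg s 1 ≡ length lI →
    reg s 7 ≡ length lJ → Logged (arr s 4) (arr s 5) lI → Logged (arr s 6) (arr s 7) lJ →
    HaltsWithin joinRuns s (4 + (suc (n * 8) + (1 + suc (n * 7)))) Done
  joinRuns-halts r₀ sI sJ r₁ r₇ (X , Y) log₇ =
    then-halts {b = 4} {Q = Found 0}
      (take-branch (const ⨾ const ⨾ copy ⨾ copy) tt
        ( (r₀ , refl , sI , sJ , r₇ , log₇) , refl
        , ([] , lists-start , trans r₁ (sym (length-map (toℕ ∘ proj₁) lI)) , X)
        , ([] , lists-start , trans r₁ (sym (length-map (toℕ ∘ proj₂) lI)) , Y)))
      λ s₁ F → then-halts (difference-halts F) λ s₂ → finish-halts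

  open Relabel swapReg swapArr swapReg-inv swapArr-inv

  construct-halts : HaltsWithin (construct k) inp (410 * n) Done
  construct-halts = within total
    (then-halts (within dfs-time (First.dfs-halts {inp} {I} root root≡0 tree (input-end L I J)
                  refl refl (λ _ → refl) (λ _ → refl) (λ _ → refl) (λ _ → refl) (λ _ → refl) (setRep-indicator I) refl))
      λ { s₁ ((r₀ , _ , _ , r₇ , a₀ , a₁ , a₃ , _ , _) , set₁ , (r₁ , log₁)) →
        then-halts (relabel-halts (within dfs-time (Second.dfs-halts s₁ {⟨ reg s₁ ∘ swapReg , arr s₁ ∘ swapArr ⟩} {J} root root≡0 tree
                      (input-end L I J) r₀ r₁ a₀ a₁ (λ _ → refl) (λ _ → refl) (λ _ → refl)
                      (λ w → trans (a₃ (toℕ w)) (setRep-indicator J w)) r₇)))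
          λ { s₂ (s′ , (R , A) , (q₀ , _ , _ , q₇ , _ , _ , e₃ , e₆ , e₇) , set₂ , (q₁ , log₂)) →
            joinRuns-halts (trans (R 0) q₀)
              (λ w → trans (A 3 (toℕ w)) (trans (e₃ (toℕ w)) (set₁ w)))
              (λ w → trans (A 2 (toℕ w)) (set₂ w))
              (trans (R 7) q₇)
              (trans (R 1) q₁)
              (logged-cong lI (λ j → trans (A 6 j) (e₆ j)) (λ j → trans (A 7 j) (e₇ j)) log₁)
              (logged-cong lJ (A 4) (A 5) log₂) } })
    where
    module First = Simulation L k 2≤k (arr inp 0) (arr inp 1) (input-seg L I J) 0 (arr inp 3) (arr inp 6) (arr inp 7)
    -- Seen through the renaming, register 7 holds the length of the first log and arrays 3, 6 and 7
    -- hold the first search's final cover and log, all of which the second search preserves.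
    module Second (s : State) =
      Simulation L k 2≤k (arr inp 0) (arr inp 1) (input-seg L I J) (length lI) (arr s 2) (arr s 4) (arr s 5)
    root≡0 : toℕ root ≡ 0
    root≡0 = proj₂ (root-of (IsTree.nonempty isTree))
    shape : ∀ n → 194 * n + (194 * n + (4 + (suc (n * 8) + (1 + suc (n * 7))))) ≡ 7 + 403 * n
    shape = solve-∀
    total : 194 * n + (194 * n + (4 + (suc (n * 8) + (1 + suc (n * 7))))) ≤ 410 * n
    -- 410 = 7 + 403, where 403 is twice 194 for the searches, 8 for the differences and 7 for
    -- undoing jumps.
    total = ≤-trans (≤-reflexive (shape n)) (affine-≤ 7 403 1≤n)

-- The equivalence and the two linear-time claims.

adjacencyLists : ∀ {n} (G : Graph n) → AdjacencyLists G
adjacencyLists {n} G = record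
  { nbrs = λ v → filter (Graph.adj? G v) (allFin n)
  ; unique = λ v → Unique.filter⁺ (Graph.adj? G v) (Unique.allFin⁺ n)
  ; correct = λ v u → mk⇔ (λ u∈ → proj₂ (∈-filter⁻ (Graph.adj? G v) {xs = allFin n} u∈)) (∈-filter⁺ (Graph.adj? G v) (∈-allFin u)) }

-- Jumps preserve cardinality. Conversely, the sequence is taken from the correctness proof of the
-- program, run on adjacency lists made with `adj?`, so one construction serves both existence and
-- linear time.
reconfigurable⇔ : (k : ℕ) → 2 ≤ k → ∀ {n} (G : Graph n) (I J : Subset n) → IsTree G →
  IsPathVertexCover k G I → IsPathVertexCover k G J → (Reconfigurable k G I J ⇔ ∣ I ∣ ≡ ∣ J ∣)
reconfigurable⇔ k 2≤k G I J tree coverI coverJ = mk⇔ (Sequences.sequence-card k G)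
  (λ card → let (_ , _ , _ , _ , S , _) = Construction.construct-halts k 2≤k (adjacencyLists G) I J tree coverI coverJ card in S)

theorem3 : (k : ℕ) → 2 ≤ k →
    (∀ {n} (T : Graph n) (I J : Subset n) → IsTree T →
      IsPathVertexCover k T I → IsPathVertexCover k T J →
      (Reconfigurable k T I J ⇔ ∣ I ∣ ≡ ∣ J ∣))
    × ConstructibleInLinearTime k
    × PVCRSolvableInLinearTime k
theorem3 k 2≤k =
    reconfigurable⇔ k 2≤k
  , (construct k , 410 , λ T L I J tree coverI coverJ S →
      Construction.construct-halts k 2≤k L I J tree coverI coverJ (Sequences.sequence-card k T S))
  -- By the equivalence it remains to compare cardinalities, in `7 + 8 * n` steps; 15 = 7 + 8.
  , (compareSizes , 15 , λ {n} T L I J tree coverI coverJ _ →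
      within (≤-trans (≤-reflexive (shape n)) (affine-≤ 7 8 (>-nonZero⁻¹ n ⦃ IsTree.nonempty tree ⦄)))
        (decide T I J tree coverI coverJ (compareSizes-halts {s = input L I J} {I} {J} refl (setRep-indicator I) (setRep-indicator J))))
  where
  shape : ∀ n → 4 + (suc (n * 8) + 2) ≡ 7 + 8 * n
  shape = solve-∀
  decide : ∀ {n P s m} (T : Graph n) (I J : Subset n) → IsTree T → IsPathVertexCover k T I → IsPathVertexCover k T J →
    HaltsWithin P s m (λ s′ → reg s′ 1 ≡ (if ∣ I ∣ ≡ᵇ ∣ J ∣ then 1 else 0)) →
    HaltsWithin P s m (OutputsDecision (Reconfigurable k T I J))
  decide T I J tree coverI coverJ (s′ , t , d , le , r₁) with ∣ I ∣ ≟ ∣ J ∣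
  ... | yes eq = s′ , t , d , le , inj₁ (Equivalence.from iff eq , trans r₁ (cong (if_then 1 else 0) (≡ᵇ-refl eq)))
    where iff = reconfigurable⇔ k 2≤k T I J tree coverI coverJ
  ... | no ne  = s′ , t , d , le , inj₂ (ne ∘ Equivalence.to iff , trans r₁ (cong (if_then 1 else 0) (≡ᵇ-≢ ne)))
    where iff = reconfigurable⇔ k 2≤k T I J tree coverI coverJ
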